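{- A sequent $\Gamma\vdash\Delta$ is derivable in $LS_{BBI}$ if and only if it is derivable in $ILS_{BBI}$.
   Context: BBI formulae: $A ::= p \mid \top \mid \bot \mid \neg A \mid A\lor A \mid A\land A \mid A\to A \mid \top^* \mid A * A \mid A \mathrel{ -\!*} A$, $p$ atomic; $\neg A$ abbreviates $A\to\bot$ and $A\lor B$ abbreviates $\neg(\neg A\land\neg B)$. Labels are label variables (from an infinite set $LVar$) or the constant $\epsilon$. A labelled formula is $w:A$; a relational atom is $(x,y\triangleright z)$ for labels $x,y,z$. A sequent $\Gamma\vdash\Delta$ has $\Gamma$ a finite multiset of labelled formulae and relational atoms and $\Delta$ a finite multiset of labelled formulae; ";" is multiset union. $\Gamma[y/x]$ replaces every occurrence of label $x$ by $y$. Rules of $LS_{BBI}$ ("from premises infer conclusion"; $P$ atomic): id: infer $\Gamma;w:P\vdash w:P;\Delta$. $\bot L$: infer $\Gamma;w:\bot\vdash\Delta$. $\top R$: infer $\Gamma\vdash w:\top;\Delta$. $\top^*R$: infer $\Gamma\vdash\epsilon:\top^*;\Delta$. cut: from $\Gamma\vdash x:A;\Delta$ and $\Gamma';x:A\vdash\Delta'$ infer $\Gamma;\Gamma'\vdash\Delta;\Delta'$. $\top^*L$: from $\Gamma[\epsilon/w]\vdash\Delta[\epsilon/w]$ infer $\Gamma;w:\top^*\vdash\Delta$ ($w\neq\epsilon$). $\land L$: from $\Gamma;w:A;w:B\vdash\Delta$ infer $\Gamma;w:A\land B\vdash\Delta$. $\land R$: from $\Gamma\vdash w:A;\Delta$ and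 $\Gamma\vdash w:B;\Delta$ infer $\Gamma\vdash w:A\land B;\Delta$. $\to L$: from $\Gamma\vdash w:A;\Delta$ and $\Gamma;w:B\vdash\Delta$ infer $\Gamma;w:A\to B\vdash\Delta$. $\to R$: from $\Gamma;w:A\vdash w:B;\Delta$ infer $\Gamma\vdash w:A\to B;\Delta$. $*L$: from $(x,y\triangleright z);\Gamma;x:A;y:B\vdash\Delta$ infer $\Gamma;z:A*B\vdash\Delta$ ($x,y$ not in the conclusion). $\mathrel{ -\!*}R$: from $(x,y\triangleright z);\Gamma;x:A\vdash z:B;\Delta$ infer $\Gamma\vdash y:A\mathrel{ -\!*}B;\Delta$ ($x,z$ not in the conclusion). $*R$: from $(x,y\triangleright z);\Gamma\vdash x:A;z:A*B;\Delta$ and $(x,y\triangleright z);\Gamma\vdash y:B;z:A*B;\Delta$ infer $(x,y\triangleright z);\Gamma\vdash z:A*B;\Delta$. $\mathrel{ -\!*}L$: from $(x,y\triangleright z);\Gamma;y:A\mathrel{ -\!*}B\vdash x:A;\Delta$ and $(x,y\triangleright z);\Gamma;y:A\mathrel{ -\!*}B;z:B\vdash\Delta$ infer $(x,y\triangleright z);\Gamma;y:A\mathrel{ -\!*}B\vdash\Delta$. E: from $(y,x\triangleright z);(x,y\triangleright z);\Gamma\vdash\Delta$ infer $(x,y\triangleright z);\Gamma\vdash\Delta$. U: from $(x,\epsilon\triangleright x);\Gamma\vdash\Delta$ infer $\Gamma\vdash\Delta$. A: from $(u,w\triangleright z);(y,v\triangleright w);(x,y\triangleright z);(u,v\triangleright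 x);\Gamma\vdash\Delta$ infer $(x,y\triangleright z);(u,v\triangleright x);\Gamma\vdash\Delta$ ($w$ not in the conclusion). $A_C$: from $(x,w\triangleright x);(y,y\triangleright w);(x,y\triangleright x);\Gamma\vdash\Delta$ infer $(x,y\triangleright x);\Gamma\vdash\Delta$ ($w$ not in the conclusion). $Eq_1$: from $(\epsilon,w'\triangleright w');\Gamma[w'/w]\vdash\Delta[w'/w]$ infer $(\epsilon,w\triangleright w');\Gamma\vdash\Delta$ ($w\neq\epsilon$). $Eq_2$: from $(\epsilon,w'\triangleright w');\Gamma[w'/w]\vdash\Delta[w'/w]$ infer $(\epsilon,w'\triangleright w);\Gamma\vdash\Delta$ ($w\neq\epsilon$). Equality entailment. An instance of $Eq_1$ acting on a set $\mathcal{G}$ of relational atoms is given by a principal atom $(\epsilon,w\triangleright w')\in\mathcal{G}$ with $w\ne\epsilon$, its substitution $\theta=[w'/w]$ and added atom $(\epsilon,w'\triangleright w')$; an instance of $Eq_2$ is given by $(\epsilon,w'\triangleright w)\in\mathcal{G}$ with $w\neq\epsilon$, $\theta=[w'/w]$, added atom $(\epsilon,w'\triangleright w')$. For a sequence $\sigma$ of such instances, $\mathcal{S}(\mathcal{G},[\,])=\mathcal{G}$ and $\mathcal{S}(\mathcal{G},[r;\sigma'])=\mathcal{S}(\mathcal{G}\theta\cup\{\text{added atom of }r\},\sigma')$ if the principal atom of $r$ lies in $\mathcal{G}$ (undefined otherwise), where $\theta$ is $r$'s substitution. $subst(\sigma)$ is the composite $\theta_1\circ\cdots\circ\theta_n$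 of the substitutions of $\sigma$ in order (apply $\theta_1$ first). $\mathcal{G}\vdash_E(u=v)$ holds iff there is such a sequence $\sigma$ with $\mathcal{S}(\mathcal{G},\sigma)$ defined and $u\theta=v\theta$ where $\theta=subst(\sigma)$. $ILS_{BBI}$ is the cut-free calculus with the rules $\bot L$, $\top R$, $\land L$, $\land R$, $\to L$, $\to R$, $*L$, $\mathrel{ -\!*}R$, E, U of $LS_{BBI}$ (unchanged), no $Eq_1$, $Eq_2$ or cut, and the following rules, where in each rule $\mathcal{G}$ denotes the set of relational atoms in the antecedent of the conclusion: id: infer $\Gamma;w_1:P\vdash w_2:P;\Delta$ provided $\mathcal{G}\vdash_E(w_1=w_2)$. $\top^*L$: from $(\epsilon,w\triangleright\epsilon);\Gamma\vdash\Delta$ infer $\Gamma;w:\top^*\vdash\Delta$. $\top^*R$: infer $\Gamma\vdash w:\top^*;\Delta$ provided $\mathcal{G}\vdash_E(w=\epsilon)$. $*R$: from $(x,y\triangleright z');\Gamma\vdash x:A;z:A*B;\Delta$ and $(x,y\triangleright z');\Gamma\vdash y:B;z:A*B;\Delta$ infer $(x,y\triangleright z');\Gamma\vdash z:A*B;\Delta$ provided $\mathcal{G}\vdash_E(z=z')$. $\mathrel{ -\!*}L$: from $(x,y'\triangleright z);\Gamma;y:A\mathrel{ -\!*}B\vdash x:A;\Delta$ and $(x,y'\triangleright z);\Gamma;y:A\mathrel{ -\!*}B;z:B\vdash\Delta$ infer $(x,y'\triangleright z);\Gamma;y:A\mathrel{ -\!*}B\vdash\Delta$ provided $\mathcal{G}\vdash_E(y=y')$.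 A: from $(u,w\triangleright z);(y,v\triangleright w);(x,y\triangleright z);(u,v\triangleright x');\Gamma\vdash\Delta$ infer $(x,y\triangleright z);(u,v\triangleright x');\Gamma\vdash\Delta$ provided $\mathcal{G}\vdash_E(x=x')$, $w$ not in the conclusion. $A_C$: from $(x,w\triangleright x');(y,y\triangleright w);(x,y\triangleright x');\Gamma\vdash\Delta$ infer $(x,y\triangleright x');\Gamma\vdash\Delta$ provided $\mathcal{G}\vdash_E(x=x')$, $w$ not in the conclusion. -}

module Defs where

open import Data.Nat using (ℕ)
open import Data.Nat.Properties using () renaming (_≟_ to _≟ℕ_)
open import Data.List using (List; []; _∷_; _++_; map; concatMap)
open import Data.List.Membership.Propositional using (_∈_; _∉_)
open import Data.List.Relation.Binary.Permutation.Propositional using (_↭_)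
open import Relation.Binary.PropositionalEquality using (_≡_; _≢_; refl; cong)
open import Relation.Nullary using (Dec; yes; no)

infixr 9 _∧_
infixr 8 _⇒_
infixr 10 _✱_
infixr 8 _−✱_

data Fml : Set where
  atom : ℕ → Fml
  ⊤ ⊥ ⊤* : Fml
  _∧_ _⇒_ _✱_ _−✱_ : Fml → Fml → Fml

¬ᶠ_ : Fml → Fml
¬ᶠ A = A ⇒ ⊥

_∨_ : Fml → Fml → Fml
A ∨ B = ¬ᶠ (¬ᶠ A ∧ ¬ᶠ B)

data Label : Set where
  ε : Label
  var : ℕ → Label

_≟L_ : (a b : Label) → Dec (a ≡ b)
ε ≟L ε = yes refl
ε ≟L var _ = no (λ ())
var _ ≟L ε = no (λ ())
var m ≟L var n with m ≟ℕ n
... | yes refl = yes refl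
... | no m≢n = no (λ { refl → m≢n refl })

subL : Label → Label → Label → Label
subL y x l with l ≟L x
... | yes _ = y
... | no _ = l

infix 6 _∶_
data LF : Set where
  _∶_ : Label → Fml → LF

data RA : Set where
  ⟨_,_▷_⟩ : Label → Label → Label → RA

data Item : Set where
  fm : LF → Item
  ra : RA → Item

-- antecedents (Γ) and succedents (Δ): finite multisets, represented as
-- lists; the calculi below contain an exchange rule (permutation),
-- so derivability is invariant under reordering.
Ante : Set
Ante = List Item

Succ : Set
Succ = List LF

subLF : Label → Label → LF → LF
subLF y x (w ∶ A) = subL y x w ∶ A

subRA : Label → Label → RA → RA
subRA y x ⟨ a , b ▷ c ⟩ = ⟨ subL y x a , subL y x b ▷ subL y x c ⟩

subItem : Label → Label → Item → Item
subItem y x (fm f) = fm (subLF y x f)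
subItem y x (ra r) = ra (subRA y x r)

subA : Label → Label → Ante → Ante
subA y x = map (subItem y x)

subS : Label → Label → Succ → Succ
subS y x = map (subLF y x)

subG : Label → Label → List RA → List RA
subG y x = map (subRA y x)

labsLF : LF → List Label
labsLF (w ∶ _) = w ∷ []

labsItem : Item → List Label
labsItem (fm f) = labsLF f
labsItem (ra ⟨ a , b ▷ c ⟩) = a ∷ b ∷ c ∷ []

labels : Ante → Succ → List Label
labels Γ Δ = concatMap labsItem Γ ++ concatMap labsLF Δ

Fresh : ℕ → Ante → Succ → Set
Fresh n Γ Δ = var n ∉ labels Γ Δ

rels : Ante → List RA
rels [] = []
rels (fm _ ∷ Γ) = rels Γ
rels (ra r ∷ Γ) = r ∷ rels Γ

-- Equality entailment  G ⊢E (u = v)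
-- G ⊢E u ≐ v  holds iff there is a sequence σ of Eq₁/Eq₂ instances with
-- S(G, σ) defined and u·subst(σ) = v·subst(σ).  (Unfolded one instance
-- at a time: the first instance r, with substitution θ = [w'/w], acts on
-- G, and the rest of the sequence acts on Gθ ∪ {(ε,w'▷w')} and on uθ, vθ.)

infix 3 _⊢E_≐_
data _⊢E_≐_ (G : List RA) : Label → Label → Set where
  E-done : ∀ {u} → G ⊢E u ≐ u
  E-eq₁  : ∀ {u v w w'} → ⟨ ε , w ▷ w' ⟩ ∈ G → w ≢ ε →
           (⟨ ε , w' ▷ w' ⟩ ∷ subG w' w G) ⊢E subL w' w u ≐ subL w' w v →
           G ⊢E u ≐ v
  E-eq₂  : ∀ {u v w w'} → ⟨ ε , w' ▷ w ⟩ ∈ G → w ≢ ε →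
           (⟨ ε , w' ▷ w' ⟩ ∷ subG w' w G) ⊢E subL w' w u ≐ subL w' w v →
           G ⊢E u ≐ v

infix 2 LS⊢ ILS⊢
syntax LS⊢ Γ Δ = Γ ⊢LS Δ
syntax ILS⊢ Γ Δ = Γ ⊢ILS Δ

data LS⊢ : Ante → Succ → Set where
  exch : ∀ {Γ Γ' Δ Δ'} → Γ ⊢LS Δ → Γ ↭ Γ' → Δ ↭ Δ' → Γ' ⊢LS Δ'
  id   : ∀ {Γ Δ w p} → (fm (w ∶ atom p) ∷ Γ) ⊢LS (w ∶ atom p ∷ Δ)
  ⊥L   : ∀ {Γ Δ w} → (fm (w ∶ ⊥) ∷ Γ) ⊢LS Δ
  ⊤R   : ∀ {Γ Δ w} → Γ ⊢LS (w ∶ ⊤ ∷ Δ)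
  ⊤*R  : ∀ {Γ Δ} → Γ ⊢LS (ε ∶ ⊤* ∷ Δ)
  cut  : ∀ {Γ Γ' Δ Δ' x A} →
         Γ ⊢LS (x ∶ A ∷ Δ) → (fm (x ∶ A) ∷ Γ') ⊢LS Δ' →
         (Γ ++ Γ') ⊢LS (Δ ++ Δ')
  ⊤*L  : ∀ {Γ Δ w} → w ≢ ε →
         subA ε w Γ ⊢LS subS ε w Δ →
         (fm (w ∶ ⊤*) ∷ Γ) ⊢LS Δ
  ∧L   : ∀ {Γ Δ w A B} → (fm (w ∶ A) ∷ fm (w ∶ B) ∷ Γ) ⊢LS Δ →
         (fm (w ∶ A ∧ B) ∷ Γ) ⊢LS Δ
  ∧R   : ∀ {Γ Δ w A B} → Γ ⊢LS (w ∶ A ∷ Δ) → Γ ⊢LS (w ∶ B ∷ Δ) →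
         Γ ⊢LS (w ∶ A ∧ B ∷ Δ)
  ⇒L   : ∀ {Γ Δ w A B} → Γ ⊢LS (w ∶ A ∷ Δ) → (fm (w ∶ B) ∷ Γ) ⊢LS Δ →
         (fm (w ∶ A ⇒ B) ∷ Γ) ⊢LS Δ
  ⇒R   : ∀ {Γ Δ w A B} → (fm (w ∶ A) ∷ Γ) ⊢LS (w ∶ B ∷ Δ) →
         Γ ⊢LS (w ∶ A ⇒ B ∷ Δ)
  ✱L   : ∀ {Γ Δ z A B} (x y : ℕ) → x ≢ y →
         Fresh x (fm (z ∶ A ✱ B) ∷ Γ) Δ → Fresh y (fm (z ∶ A ✱ B) ∷ Γ) Δ →
         (ra ⟨ var x , var y ▷ z ⟩ ∷ fm (var x ∶ A) ∷ fm (var y ∶ B) ∷ Γ) ⊢LS Δ →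
         (fm (z ∶ A ✱ B) ∷ Γ) ⊢LS Δ
  −✱R  : ∀ {Γ Δ y A B} (x z : ℕ) → x ≢ z →
         Fresh x Γ (y ∶ A −✱ B ∷ Δ) → Fresh z Γ (y ∶ A −✱ B ∷ Δ) →
         (ra ⟨ var x , y ▷ var z ⟩ ∷ fm (var x ∶ A) ∷ Γ) ⊢LS (var z ∶ B ∷ Δ) →
         Γ ⊢LS (y ∶ A −✱ B ∷ Δ)
  ✱R   : ∀ {Γ Δ x y z A B} →
         (ra ⟨ x , y ▷ z ⟩ ∷ Γ) ⊢LS (x ∶ A ∷ z ∶ A ✱ B ∷ Δ) →
         (ra ⟨ x , y ▷ z ⟩ ∷ Γ) ⊢LS (y ∶ B ∷ z ∶ A ✱ B ∷ Δ) →
         (ra ⟨ x , y ▷ z ⟩ ∷ Γ) ⊢LS (z ∶ A ✱ B ∷ Δ)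
  −✱L  : ∀ {Γ Δ x y z A B} →
         (ra ⟨ x , y ▷ z ⟩ ∷ fm (y ∶ A −✱ B) ∷ Γ) ⊢LS (x ∶ A ∷ Δ) →
         (ra ⟨ x , y ▷ z ⟩ ∷ fm (y ∶ A −✱ B) ∷ fm (z ∶ B) ∷ Γ) ⊢LS Δ →
         (ra ⟨ x , y ▷ z ⟩ ∷ fm (y ∶ A −✱ B) ∷ Γ) ⊢LS Δ
  E    : ∀ {Γ Δ x y z} →
         (ra ⟨ y , x ▷ z ⟩ ∷ ra ⟨ x , y ▷ z ⟩ ∷ Γ) ⊢LS Δ →
         (ra ⟨ x , y ▷ z ⟩ ∷ Γ) ⊢LS Δ
  U    : ∀ {Γ Δ x} → (ra ⟨ x , ε ▷ x ⟩ ∷ Γ) ⊢LS Δ → Γ ⊢LS Δ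
  A    : ∀ {Γ Δ x y z u v} (w : ℕ) →
         Fresh w (ra ⟨ x , y ▷ z ⟩ ∷ ra ⟨ u , v ▷ x ⟩ ∷ Γ) Δ →
         (ra ⟨ u , var w ▷ z ⟩ ∷ ra ⟨ y , v ▷ var w ⟩ ∷
            ra ⟨ x , y ▷ z ⟩ ∷ ra ⟨ u , v ▷ x ⟩ ∷ Γ) ⊢LS Δ →
         (ra ⟨ x , y ▷ z ⟩ ∷ ra ⟨ u , v ▷ x ⟩ ∷ Γ) ⊢LS Δ
  AC   : ∀ {Γ Δ x y} (w : ℕ) →
         Fresh w (ra ⟨ x , y ▷ x ⟩ ∷ Γ) Δ →
         (ra ⟨ x , var w ▷ x ⟩ ∷ ra ⟨ y , y ▷ var w ⟩ ∷ ra ⟨ x , y ▷ x ⟩ ∷ Γ) ⊢LS Δ →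
         (ra ⟨ x , y ▷ x ⟩ ∷ Γ) ⊢LS Δ
  Eq₁  : ∀ {Γ Δ w w'} → w ≢ ε →
         (ra ⟨ ε , w' ▷ w' ⟩ ∷ subA w' w Γ) ⊢LS subS w' w Δ →
         (ra ⟨ ε , w ▷ w' ⟩ ∷ Γ) ⊢LS Δ
  Eq₂  : ∀ {Γ Δ w w'} → w ≢ ε →
         (ra ⟨ ε , w' ▷ w' ⟩ ∷ subA w' w Γ) ⊢LS subS w' w Δ →
         (ra ⟨ ε , w' ▷ w ⟩ ∷ Γ) ⊢LS Δ

data ILS⊢ : Ante → Succ → Set where
  exch : ∀ {Γ Γ' Δ Δ'} → Γ ⊢ILS Δ → Γ ↭ Γ' → Δ ↭ Δ' → Γ' ⊢ILS Δ'
  id   : ∀ {Γ Δ w₁ w₂ p} →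
         rels (fm (w₁ ∶ atom p) ∷ Γ) ⊢E w₁ ≐ w₂ →
         (fm (w₁ ∶ atom p) ∷ Γ) ⊢ILS (w₂ ∶ atom p ∷ Δ)
  ⊥L   : ∀ {Γ Δ w} → (fm (w ∶ ⊥) ∷ Γ) ⊢ILS Δ
  ⊤R   : ∀ {Γ Δ w} → Γ ⊢ILS (w ∶ ⊤ ∷ Δ)
  ⊤*R  : ∀ {Γ Δ w} → rels Γ ⊢E w ≐ ε → Γ ⊢ILS (w ∶ ⊤* ∷ Δ)
  ⊤*L  : ∀ {Γ Δ w} →
         (ra ⟨ ε , w ▷ ε ⟩ ∷ Γ) ⊢ILS Δ →
         (fm (w ∶ ⊤*) ∷ Γ) ⊢ILS Δ
  ∧L   : ∀ {Γ Δ w A B} → (fm (w ∶ A) ∷ fm (w ∶ B) ∷ Γ) ⊢ILS Δ →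
         (fm (w ∶ A ∧ B) ∷ Γ) ⊢ILS Δ
  ∧R   : ∀ {Γ Δ w A B} → Γ ⊢ILS (w ∶ A ∷ Δ) → Γ ⊢ILS (w ∶ B ∷ Δ) →
         Γ ⊢ILS (w ∶ A ∧ B ∷ Δ)
  ⇒L   : ∀ {Γ Δ w A B} → Γ ⊢ILS (w ∶ A ∷ Δ) → (fm (w ∶ B) ∷ Γ) ⊢ILS Δ →
         (fm (w ∶ A ⇒ B) ∷ Γ) ⊢ILS Δ
  ⇒R   : ∀ {Γ Δ w A B} → (fm (w ∶ A) ∷ Γ) ⊢ILS (w ∶ B ∷ Δ) →
         Γ ⊢ILS (w ∶ A ⇒ B ∷ Δ)
  ✱L   : ∀ {Γ Δ z A B} (x y : ℕ) → x ≢ y →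
         Fresh x (fm (z ∶ A ✱ B) ∷ Γ) Δ → Fresh y (fm (z ∶ A ✱ B) ∷ Γ) Δ →
         (ra ⟨ var x , var y ▷ z ⟩ ∷ fm (var x ∶ A) ∷ fm (var y ∶ B) ∷ Γ) ⊢ILS Δ →
         (fm (z ∶ A ✱ B) ∷ Γ) ⊢ILS Δ
  −✱R  : ∀ {Γ Δ y A B} (x z : ℕ) → x ≢ z →
         Fresh x Γ (y ∶ A −✱ B ∷ Δ) → Fresh z Γ (y ∶ A −✱ B ∷ Δ) →
         (ra ⟨ var x , y ▷ var z ⟩ ∷ fm (var x ∶ A) ∷ Γ) ⊢ILS (var z ∶ B ∷ Δ) →
         Γ ⊢ILS (y ∶ A −✱ B ∷ Δ)
  ✱R   : ∀ {Γ Δ x y z z' A B} →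
         rels (ra ⟨ x , y ▷ z' ⟩ ∷ Γ) ⊢E z ≐ z' →
         (ra ⟨ x , y ▷ z' ⟩ ∷ Γ) ⊢ILS (x ∶ A ∷ z ∶ A ✱ B ∷ Δ) →
         (ra ⟨ x , y ▷ z' ⟩ ∷ Γ) ⊢ILS (y ∶ B ∷ z ∶ A ✱ B ∷ Δ) →
         (ra ⟨ x , y ▷ z' ⟩ ∷ Γ) ⊢ILS (z ∶ A ✱ B ∷ Δ)
  −✱L  : ∀ {Γ Δ x y y' z A B} →
         rels (ra ⟨ x , y' ▷ z ⟩ ∷ fm (y ∶ A −✱ B) ∷ Γ) ⊢E y ≐ y' →
         (ra ⟨ x , y' ▷ z ⟩ ∷ fm (y ∶ A −✱ B) ∷ Γ) ⊢ILS (x ∶ A ∷ Δ) →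
         (ra ⟨ x , y' ▷ z ⟩ ∷ fm (y ∶ A −✱ B) ∷ fm (z ∶ B) ∷ Γ) ⊢ILS Δ →
         (ra ⟨ x , y' ▷ z ⟩ ∷ fm (y ∶ A −✱ B) ∷ Γ) ⊢ILS Δ
  E    : ∀ {Γ Δ x y z} →
         (ra ⟨ y , x ▷ z ⟩ ∷ ra ⟨ x , y ▷ z ⟩ ∷ Γ) ⊢ILS Δ →
         (ra ⟨ x , y ▷ z ⟩ ∷ Γ) ⊢ILS Δ
  U    : ∀ {Γ Δ x} → (ra ⟨ x , ε ▷ x ⟩ ∷ Γ) ⊢ILS Δ → Γ ⊢ILS Δ
  A    : ∀ {Γ Δ x x' y z u v} (w : ℕ) →
         rels (ra ⟨ x , y ▷ z ⟩ ∷ ra ⟨ u , v ▷ x' ⟩ ∷ Γ) ⊢E x ≐ x' →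
         Fresh w (ra ⟨ x , y ▷ z ⟩ ∷ ra ⟨ u , v ▷ x' ⟩ ∷ Γ) Δ →
         (ra ⟨ u , var w ▷ z ⟩ ∷ ra ⟨ y , v ▷ var w ⟩ ∷
            ra ⟨ x , y ▷ z ⟩ ∷ ra ⟨ u , v ▷ x' ⟩ ∷ Γ) ⊢ILS Δ →
         (ra ⟨ x , y ▷ z ⟩ ∷ ra ⟨ u , v ▷ x' ⟩ ∷ Γ) ⊢ILS Δ
  AC   : ∀ {Γ Δ x x' y} (w : ℕ) →
         rels (ra ⟨ x , y ▷ x' ⟩ ∷ Γ) ⊢E x ≐ x' →
         Fresh w (ra ⟨ x , y ▷ x' ⟩ ∷ Γ) Δ →
         (ra ⟨ x , var w ▷ x' ⟩ ∷ ra ⟨ y , y ▷ var w ⟩ ∷ ra ⟨ x , y ▷ x' ⟩ ∷ Γ) ⊢ILS Δ →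
         (ra ⟨ x , y ▷ x' ⟩ ∷ Γ) ⊢ILS Δ

{-# OPTIONS --safe #-}
module Submission where

-- Both directions pass through label equality generated by (a,b ▷ c) with a = ε, which forces b = c; this is
-- what ⊢E decides by substitution. For LS → ILS, cuts are eliminated in an intermediate calculus ⊢_, in which
-- sequents are read up to that equality, rules keep their principal items, and a rule with an eigenvariable
-- has one premise for every label. Weakening, contraction and replacement of equal labels are then a single
-- monotonicity property, with no freshness conditions. For ILS → LS, the Eq rules of LS are run along the
-- derivation of a side condition, after which its two labels coincide and the rule of LS applies.

open import Defs
open import Data.Bool using (Bool; true; false)
open import Data.Empty renaming (⊥ to Empty) using ()
open import Data.List using (List; []; _∷_; _++_; map; concatMap)
open import Data.List.Membership.Propositional using (_∈_; _∉_)
open import Data.List.Membership.Propositional.Properties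
  using (∈-++⁺ˡ; ∈-++⁺ʳ; ∈-++⁻; ∈-map⁺; ∈-map⁻; ∈-concatMap⁺; ∈-∃++)
open import Data.List.Properties
  using (map-cong; map-cong-local; map-id; map-∘; map-++; ++-assoc; ++-identityʳ; ∷-injectiveʳ)
open import Data.List.Relation.Binary.Permutation.Propositional
  using (_↭_; ↭-refl; ↭-sym; ↭-trans; ↭-reflexive; prep)
open import Data.List.Relation.Binary.Permutation.Propositional.Properties
  using (All-resp-↭; ∈-resp-↭; shift; ++⁺ʳ) renaming (map⁺ to ↭-map⁺)
open import Data.List.Relation.Binary.Pointwise as Pointwise using (Pointwise; []; _∷_)
open import Data.List.Relation.Unary.All as All using (All; []; _∷_)
open import Data.List.Relation.Unary.All.Properties using (++⁻)
open import Data.List.Relation.Unary.Any as Any using (Any; here; there)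
open import Data.Nat using (ℕ; suc; _⊔_; _<_)
import Data.Nat.Properties as ℕ
open import Data.Product using (_×_; _,_; ∃-syntax)
open import Data.Sum as Sum using (_⊎_; inj₁; inj₂)
open import Data.Unit using (tt) renaming (⊤ to Unit)
open import Function using (_∘_; case_of_) renaming (id to id→)
open import Relation.Binary.PropositionalEquality
  using (_≡_; _≢_; refl; sym; trans; cong; cong₂; subst; subst₂)
open import Relation.Nullary using (yes; no; contradiction)

-- In LS the rules `⊤*L`, `Eq₁` and `Eq₂` rewrite the whole sequent, so a cut cannot be moved past
-- them without rewriting its other premise as well. With equality as a relation on labels that stay
-- in place, an Eq step leaves the interpreted sequent unchanged and `⊤*L` merely adds an atom. The
-- price is paid on leaving the intermediate calculus: the relation must be shown to be no stronger
-- than the destructive procedure `⊢E`. The critical property is stability of `⊢E` under renamings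
-- (`≐-rename`), since transitivity means replaying one sequence of substitutions after another.
-- Such renamings may merge labels or send them to `ε`, so an Eq instance can degenerate. The same
-- degenerate cases return in the converse direction, where renamings are carried through LS
-- derivations although `⊤*L`, `Eq₁` and `Eq₂` demand a label other than `ε`.

-- Renamings, substitutions and fresh labels

Renaming : Set
Renaming = Label → Label

renameRA : Renaming → RA → RA
renameRA f ⟨ x , y ▷ z ⟩ = ⟨ f x , f y ▷ f z ⟩

renameItem : Renaming → Item → Item
renameItem f (fm (w ∶ F)) = fm (f w ∶ F)
renameItem f (ra r) = ra (renameRA f r)

renameLF : Renaming → LF → LF
renameLF f (w ∶ F) = f w ∶ F

subL-self : ∀ y x → subL y x x ≡ y
subL-self y x with x ≟L x
... | yes _ = refl
... | no x≢x = contradiction refl x≢x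

subL-target : ∀ y x → subL y x y ≡ y
subL-target y x with y ≟L x
... | yes _ = refl
... | no _ = refl

subL-ε : ∀ {y x} → x ≢ ε → subL y x ε ≡ ε
subL-ε {x = x} x≢ε with ε ≟L x
... | yes e = contradiction (sym e) x≢ε
... | no _ = refl

subL-εε : ∀ x → subL ε x ε ≡ ε
subL-εε x with ε ≟L x
... | yes _ = refl
... | no _ = refl

-- A renaming that identifies x and y absorbs [y/x]. This is how premises with a substitution are
-- matched with renamed sequents later on.
subL-invariant : ∀ (f : Renaming) {x y} → f x ≡ f y → ∀ l → f (subL y x l) ≡ f l
subL-invariant f {x} e l with l ≟L x
... | yes refl = sym e
... | no _ = refl

_[_≔_] : Renaming → ℕ → Label → Renaming
(f [ n ≔ l ]) ε = f ε
(f [ n ≔ l ]) (var m) with m ℕ.≟ n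
... | yes _ = l
... | no _  = f (var m)

≔-same : ∀ f n l → (f [ n ≔ l ]) (var n) ≡ l
≔-same f n l with n ℕ.≟ n
... | yes _ = refl
... | no n≢n = contradiction refl n≢n

≔-other : ∀ f {n l} k → k ≢ var n → (f [ n ≔ l ]) k ≡ f k
≔-other f ε _ = refl
≔-other f {n} (var m) k≢n with m ℕ.≟ n
... | yes refl = contradiction refl k≢n
... | no _ = refl

freshItem : ∀ {n Γ Δ} → Fresh n Γ Δ → All (λ i → var n ∉ labsItem i) Γ
freshItem fr = All.tabulate λ m k → fr (∈-++⁺ˡ (∈-concatMap⁺ labsItem (Any.map (λ { refl → k }) m)))

freshLF : ∀ {n} Γ {Δ} → Fresh n Γ Δ → All (λ i → var n ∉ labsLF i) Δ
freshLF Γ fr = All.tabulate λ m k → fr (∈-++⁺ʳ _ (∈-concatMap⁺ labsLF (Any.map (λ { refl → k }) m)))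

renameItem-≔ : ∀ f {n l} i → var n ∉ labsItem i → renameItem (f [ n ≔ l ]) i ≡ renameItem f i
renameItem-≔ f {n} {l} (fm (w ∶ F)) fr rewrite ≔-other f {n} {l} w (λ { refl → fr (here refl) }) = refl
renameItem-≔ f {n} {l} (ra ⟨ x , y ▷ z ⟩) fr
  rewrite ≔-other f {n} {l} x (λ { refl → fr (here refl) })
        | ≔-other f {n} {l} y (λ { refl → fr (there (here refl)) })
        | ≔-other f {n} {l} z (λ { refl → fr (there (there (here refl))) }) = refl

renameLF-≔ : ∀ f {n l} j → var n ∉ labsLF j → renameLF (f [ n ≔ l ]) j ≡ renameLF f j
renameLF-≔ f {n} {l} (w ∶ F) fr rewrite ≔-other f {n} {l} w (λ { refl → fr (here refl) }) = refl

bound : List Label → ℕ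
bound [] = 0
bound (ε ∷ ls) = bound ls
bound (var n ∷ ls) = suc n ⊔ bound ls

<-bound : ∀ {n ls} → var n ∈ ls → n < bound ls
<-bound {n} {_ ∷ ls} (here refl) = ℕ.m≤m⊔n (suc n) (bound ls)
<-bound {n} {ε ∷ ls} (there m) = <-bound m
<-bound {n} {var k ∷ ls} (there m) = ℕ.≤-trans (<-bound m) (ℕ.m≤n⊔m (suc k) (bound ls))

fresh : ∀ ls → ∃[ n ] var n ∉ ls
fresh ls = bound ls , λ m → ℕ.<-irrefl refl (<-bound m)

fresh₂ : ∀ ls → ∃[ m ] ∃[ n ] m ≢ n × var m ∉ ls × var n ∉ ls
fresh₂ ls with fresh ls
... | m , m∉ with fresh (var m ∷ ls)
...   | n , n∉ = m , n , (λ { refl → n∉ (here refl) }) , m∉ , n∉ ∘ there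

-- The intermediate calculus

data Sign : Set where
  L R : Sign

data It : Set where
  rel : Label → Label → Label → It
  sg  : Sign → Label → Fml → It

Seq : Set
Seq = List It

infix 4 _~[_]_ _≈[_]_ _⊩_ _≤_

-- `~unit` asks for a label equal to `ε`, not for `ε` itself: only so does an atom known up to
-- equality yield its equation (`~-unit`), which monotonicity needs.
data _~[_]_ : Label → Seq → Label → Set where
  ~refl  : ∀ {S u} → u ~[ S ] u
  ~sym   : ∀ {S u v} → u ~[ S ] v → v ~[ S ] u
  ~trans : ∀ {S u v w} → u ~[ S ] v → v ~[ S ] w → u ~[ S ] w
  ~unit  : ∀ {S a u v} → rel a u v ∈ S → a ~[ S ] ε → u ~[ S ] v

data _≈[_]_ : It → Seq → It → Set where
  rel : ∀ {S x x' y y' z z'} → x ~[ S ] x' → y ~[ S ] y' → z ~[ S ] z' →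
        rel x y z ≈[ S ] rel x' y' z'
  sg  : ∀ {S s w w' F} → w ~[ S ] w' → sg s w F ≈[ S ] sg s w' F

_⊩_ : Seq → It → Set
S ⊩ a = ∃[ b ] b ∈ S × a ≈[ S ] b

_≤_ : Seq → Seq → Set
S ≤ T = ∀ {a} → a ∈ S → T ⊩ a

≈-refl : ∀ {S a} → a ≈[ S ] a
≈-refl {a = rel _ _ _} = rel ~refl ~refl ~refl
≈-refl {a = sg _ _ _}  = sg ~refl

≈-sym : ∀ {S a b} → a ≈[ S ] b → b ≈[ S ] a
≈-sym (rel p q r) = rel (~sym p) (~sym q) (~sym r)
≈-sym (sg p)      = sg (~sym p)

≈-trans : ∀ {S a b c} → a ≈[ S ] b → b ≈[ S ] c → a ≈[ S ] c
≈-trans (rel p q r) (rel p' q' r') = rel (~trans p p') (~trans q q') (~trans r r')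
≈-trans (sg p) (sg p')             = sg (~trans p p')

≈-map : ∀ {S T} → (∀ {u v} → u ~[ S ] v → u ~[ T ] v) → ∀ {a b} → a ≈[ S ] b → a ≈[ T ] b
≈-map g (rel p q r) = rel (g p) (g q) (g r)
≈-map g (sg p)      = sg (g p)

∈⇒⊩ : ∀ {S a} → a ∈ S → S ⊩ a
∈⇒⊩ m = _ , m , ≈-refl

⊩-resp : ∀ {S a b} → a ≈[ S ] b → S ⊩ b → S ⊩ a
⊩-resp e (c , m , e') = c , m , ≈-trans e e'

~-unit : ∀ {S a u v} → S ⊩ rel a u v → a ~[ S ] ε → u ~[ S ] v
~-unit (_ , m , rel p q r) e = ~trans q (~trans (~unit m (~trans (~sym p) e)) (~sym r))

~-mono : ∀ {S T} → S ≤ T → ∀ {u v} → u ~[ S ] v → u ~[ T ] v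
~-mono le ~refl        = ~refl
~-mono le (~sym p)     = ~sym (~-mono le p)
~-mono le (~trans p q) = ~trans (~-mono le p) (~-mono le q)
~-mono le (~unit m e)  = ~-unit (le m) (~-mono le e)

⊩-mono : ∀ {S T} → S ≤ T → ∀ {a} → S ⊩ a → T ⊩ a
⊩-mono le (b , m , e) = ⊩-resp (≈-map (~-mono le) e) (le m)

≤-refl : ∀ {S} → S ≤ S
≤-refl = ∈⇒⊩

≤-trans : ∀ {S T V} → S ≤ T → T ≤ V → S ≤ V
≤-trans p q m = ⊩-mono q (p m)

≤-++ʳ : ∀ B {S} → S ≤ B ++ S
≤-++ʳ B m = ∈⇒⊩ (∈-++⁺ʳ B m)

≤-++ˡ : ∀ B {S} → B ≤ B ++ S
≤-++ˡ B m = ∈⇒⊩ (∈-++⁺ˡ m)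

≤-++ : ∀ B {S T} → B ≤ T → S ≤ T → B ++ S ≤ T
≤-++ B p q m with ∈-++⁻ B m
... | inj₁ m' = p m'
... | inj₂ m' = q m'

≤-∷ : ∀ {a S T} → T ⊩ a → S ≤ T → a ∷ S ≤ T
≤-∷ p q (here refl) = p
≤-∷ p q (there m)   = q m

≤-tail : ∀ {a S T} → a ∷ S ≤ T → S ≤ T
≤-tail p m = p (there m)

++-mono : ∀ B {S T} → S ≤ T → B ++ S ≤ B ++ T
++-mono B le = ≤-++ B (≤-++ˡ B) (≤-trans le (≤-++ʳ B))

-- The logical rules of ILS that do not repeat their principal formula in the premises.
data Decomp : Sign → Fml → Set where
  ⊥L  : Decomp L ⊥
  ⊤R  : Decomp R ⊤
  ⊤*L : Decomp L ⊤*
  ∧L  : ∀ {F H} → Decomp L (F ∧ H)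
  ∧R  : ∀ {F H} → Decomp R (F ∧ H)
  ⇒L  : ∀ {F H} → Decomp L (F ⇒ H)
  ⇒R  : ∀ {F H} → Decomp R (F ⇒ H)
  ✱L  : ∀ {F H} → Decomp L (F ✱ H)
  −✱R : ∀ {F H} → Decomp R (F −✱ H)

DecompIx : ∀ {s F} → Decomp s F → Set
DecompIx ⊥L  = Empty
DecompIx ⊤R  = Empty
DecompIx ⊤*L = Unit
DecompIx ∧L  = Unit
DecompIx ∧R  = Bool
DecompIx ⇒L  = Bool
DecompIx ⇒R  = Unit
DecompIx ✱L  = Label × Label
DecompIx −✱R = Label × Label

parts : ∀ {s F} (d : Decomp s F) → Label → DecompIx d → Seq
parts ⊥L _ ()
parts ⊤R _ ()
parts ⊤*L w _ = rel ε w ε ∷ []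
parts (∧L {F} {H}) w _ = sg L w F ∷ sg L w H ∷ []
parts (∧R {F} {H}) w true  = sg R w F ∷ []
parts (∧R {F} {H}) w false = sg R w H ∷ []
parts (⇒L {F} {H}) w true  = sg R w F ∷ []
parts (⇒L {F} {H}) w false = sg L w H ∷ []
parts (⇒R {F} {H}) w _ = sg L w F ∷ sg R w H ∷ []
parts (✱L {F} {H}) w (x , y) = rel x y w ∷ sg L x F ∷ sg L y H ∷ []
parts (−✱R {F} {H}) w (x , z) = rel x w z ∷ sg L x F ∷ sg R z H ∷ []

Decomp-unique : ∀ {s F} (d d' : Decomp s F) → d ≡ d'
Decomp-unique ⊥L ⊥L = refl
Decomp-unique ⊤R ⊤R = refl
Decomp-unique ⊤*L ⊤*L = refl
Decomp-unique ∧L ∧L = refl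
Decomp-unique ∧R ∧R = refl
Decomp-unique ⇒L ⇒L = refl
Decomp-unique ⇒R ⇒R = refl
Decomp-unique ✱L ✱L = refl
Decomp-unique −✱R −✱R = refl

parts-≈ : ∀ {S s F} (d : Decomp s F) {w w'} i → w ~[ S ] w' →
          Pointwise (_≈[ S ]_) (parts d w i) (parts d w' i)
parts-≈ ⊥L () e
parts-≈ ⊤R () e
parts-≈ ⊤*L i e = rel ~refl e ~refl ∷ []
parts-≈ ∧L i e = sg e ∷ sg e ∷ []
parts-≈ ∧R true e = sg e ∷ []
parts-≈ ∧R false e = sg e ∷ []
parts-≈ ⇒L true e = sg e ∷ []
parts-≈ ⇒L false e = sg e ∷ []
parts-≈ ⇒R i e = sg e ∷ sg e ∷ []
parts-≈ ✱L i e = rel ~refl ~refl e ∷ sg ~refl ∷ sg ~refl ∷ []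
parts-≈ −✱R i e = rel ~refl e ~refl ∷ sg ~refl ∷ sg ~refl ∷ []

data Rule : Seq → Set where
  dec : ∀ {s F} → Decomp s F → ∀ w → Rule (sg s w F ∷ [])
  id  : ∀ {w p} → Rule (sg R w (atom p) ∷ sg L w (atom p) ∷ [])
  ⊤*R : Rule (sg R ε ⊤* ∷ [])
  ✱R  : ∀ {x y z F H} → Rule (sg R z (F ✱ H) ∷ rel x y z ∷ [])
  −✱L : ∀ {x y z F H} → Rule (sg L y (F −✱ H) ∷ rel x y z ∷ [])
  E   : ∀ {x y z} → Rule (rel x y z ∷ [])
  U   : Label → Rule []
  -- AC is the instance in which both principal items are the same one.
  A   : ∀ {x y z u v} → Rule (rel x y z ∷ rel u v x ∷ [])

Ix : ∀ {ps} → Rule ps → Set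
Ix (dec d _) = DecompIx d
Ix id        = Empty
Ix ⊤*R       = Empty
Ix ✱R        = Bool
Ix −✱L       = Bool
Ix E         = Unit
Ix (U _)     = Unit
Ix A         = Label

adds : ∀ {ps} (r : Rule ps) → Ix r → Seq
adds (dec d w) i = parts d w i
adds id ()
adds ⊤*R ()
adds (✱R {x} {y} {z} {F} {H}) true   = sg R x F ∷ []
adds (✱R {x} {y} {z} {F} {H}) false  = sg R y H ∷ []
adds (−✱L {x} {y} {z} {F} {H}) true  = sg R x F ∷ []
adds (−✱L {x} {y} {z} {F} {H}) false = sg L z H ∷ []
adds (E {x} {y} {z}) _ = rel y x z ∷ []
adds (U x) _ = rel x ε x ∷ []
adds (A {x} {y} {z} {u} {v}) w = rel u w z ∷ rel y v w ∷ []

infix 3 ⊢_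
-- Principal items are required only through `⊩`, so two items that share a label in `Rule` may
-- occur in S with merely equal labels. This absorbs all the side conditions of ILS.
data ⊢_ (S : Seq) : Set where
  step : ∀ {ps} (r : Rule ps) → All (S ⊩_) ps → (∀ i → ⊢ adds r i ++ S) → ⊢ S

transfer : ∀ {S T} → S ≤ T → ⊢ S → ⊢ T
transfer le (step r ps k) =
  step r (All.map (⊩-mono le) ps) (λ i → transfer (++-mono (adds r i) le) (k i))

-- Inversion and cut admissibility

-- Equations come from relational atoms alone, so removing a cut formula loses none.
~-strengthen : ∀ {T s w F u v} → u ~[ sg s w F ∷ T ] v → u ~[ T ] v
~-strengthen ~refl = ~refl
~-strengthen (~sym p) = ~sym (~-strengthen p)
~-strengthen (~trans p q) = ~trans (~-strengthen p) (~-strengthen q)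
~-strengthen (~unit (there m) e) = ~unit m (~-strengthen e)

⊩-split : ∀ {T s w F a} → sg s w F ∷ T ⊩ a → a ≈[ T ] sg s w F ⊎ T ⊩ a
⊩-split (b , here refl , e) = inj₁ (≈-map ~-strengthen e)
⊩-split (b , there m , e)   = inj₂ (b , m , ≈-map ~-strengthen e)

All-split : ∀ {P Q : It → Set} {ps} → All (λ p → P p ⊎ Q p) ps → Any P ps ⊎ All Q ps
All-split [] = inj₂ []
All-split (inj₁ p ∷ ps) = inj₁ (here p)
All-split (inj₂ q ∷ ps) with All-split ps
... | inj₁ x = inj₁ (there x)
... | inj₂ y = inj₂ (q ∷ y)

≤-there : ∀ {a S T} → S ≤ T → S ≤ a ∷ T
≤-there le = ≤-trans le (≤-++ʳ (_ ∷ []))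

≤-keep : ∀ {a S T} → S ≤ T → a ∷ S ≤ a ∷ T
≤-keep = ++-mono (_ ∷ [])

≤-swap : ∀ {a b S T} → S ≤ T → a ∷ S ≤ a ∷ b ∷ T
≤-swap le = ≤-keep (≤-there le)

≤-Pointwise : ∀ {B C V} → Pointwise (_≈[ V ]_) B C → C ≤ V → B ≤ V
≤-Pointwise (e ∷ es) le (here refl) = ⊩-resp e (le (here refl))
≤-Pointwise (e ∷ es) le (there m)   = ≤-Pointwise es (≤-tail le) m

-- What a last step leaves when the formula to be eliminated is principal in it: premises already
-- freed of that formula, the other principal item found in V, and everything read at the label w.
data Principal (V : Seq) (w : Label) : Sign → Fml → Set where
  dec : ∀ {s F} (d : Decomp s F) → (∀ i → ⊢ parts d w i ++ V) → Principal V w s F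
  idR : ∀ {p} → V ⊩ sg L w (atom p) → Principal V w R (atom p)
  idL : ∀ {p} → V ⊩ sg R w (atom p) → Principal V w L (atom p)
  ⊤*R : w ~[ V ] ε → Principal V w R ⊤*
  ✱R  : ∀ {x y F H} → V ⊩ rel x y w →
        ⊢ sg R x F ∷ V → ⊢ sg R y H ∷ V → Principal V w R (F ✱ H)
  −✱L : ∀ {x z F H} → V ⊩ rel x w z →
        ⊢ sg R x F ∷ V → ⊢ sg L z H ∷ V → Principal V w L (F −✱ H)

-- No rule uses one signed formula twice: the two items of `id` differ in sign, and elsewhere the
-- second item is a relational atom. Hence the remaining item must lie in V.
principal : ∀ {V s w F ps} (r : Rule ps) →
  Any (_≈[ V ] sg s w F) ps → All (λ p → p ≈[ V ] sg s w F ⊎ V ⊩ p) ps →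
  (∀ i → ⊢ adds r i ++ V) → Principal V w s F
principal (dec d w') (here (sg e)) _ k = dec d λ i →
  transfer (≤-++ (parts d w' i) (≤-Pointwise (parts-≈ d i (~-mono (≤-++ʳ _) e)) (≤-++ˡ _)) (≤-++ʳ _)) (k i)
principal id (here (sg e)) (_ ∷ inj₂ m ∷ []) k = idR (⊩-resp (sg (~sym e)) m)
principal id (there (here (sg e))) (inj₂ m ∷ _) k = idL (⊩-resp (sg (~sym e)) m)
principal ⊤*R (here (sg e)) _ k = ⊤*R (~sym e)
principal ✱R (here (sg e)) (_ ∷ inj₂ m ∷ []) k =
  ✱R (⊩-resp (rel ~refl ~refl (~sym e)) m) (k true) (k false)
principal −✱L (here (sg e)) (_ ∷ inj₂ m ∷ []) k =
  −✱L (⊩-resp (rel ~refl (~sym e) ~refl) m) (k true) (k false)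
principal ✱R (there (here ()))
principal −✱L (there (here ()))
principal A (there (here ()))

-- V ranges over all extensions of T because items accumulate on the way up to the step where the
-- formula is principal.
Reduces : Seq → Label → Sign → Fml → Set
Reduces T w s F = ∀ {V} → T ≤ V → Principal V w s F → ⊢ V

-- The premises are treated first, so a formula kept by its rule and used again higher up is already
-- gone from them. A step that does not use it is repeated over V; one that does is handed to the
-- reduction. Inversion and cut are both instances.
eliminate-under : ∀ {S T V s w F} → Reduces T w s F → T ≤ V → S ≤ sg s w F ∷ V → ⊢ S → ⊢ V
eliminate-under h t le (step r ps k) with All.map (λ p → ⊩-split (⊩-mono le p)) ps
... | qs with All-split qs | (λ i → eliminate-under h (≤-trans t (≤-++ʳ (adds r i)))
                 (≤-++ (adds r i) (≤-there (≤-++ˡ _)) (≤-trans le (≤-keep (≤-++ʳ (adds r i))))) (k i))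
... | inj₂ all | k' = step r all k'
... | inj₁ any | k' = h t (principal r any qs k')

eliminate : ∀ {T s w F} → Reduces T w s F → ⊢ sg s w F ∷ T → ⊢ T
eliminate h = eliminate-under h ≤-refl ≤-refl

-- With the parts already in the context, a step decomposing the formula is replaced by its i-th
-- premise, whose copy of the parts contracts. The other forms of `Principal` concern signed
-- formulae without a `Decomp`.
invert : ∀ {s w F T} (d : Decomp s F) i → ⊢ sg s w F ∷ T → ⊢ parts d w i ++ T
invert {s} {w} {F} {T} d i p = eliminate reduces (transfer (≤-keep (≤-++ʳ _)) p)
  where
  reduces : Reduces (parts d w i ++ T) w s F
  reduces le (dec d' k) with Decomp-unique d d'
  ... | refl = transfer (≤-++ _ (≤-trans (≤-++ˡ _) le) ≤-refl) (k i)
  reduces le (idR _) = case d of λ ()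
  reduces le (idL _) = case d of λ ()
  reduces le (⊤*R _) = case d of λ ()
  reduces le (✱R _ _ _) = case d of λ ()
  reduces le (−✱L _ _ _) = case d of λ ()

-- Each of ⊤*, ∧, ⇒, ✱, −✱ has a side on which its rule is invertible; that side is inverted, so that
-- a single induction, on the derivation of the other premise, suffices.
cut-admissible : ∀ F {w T} → ⊢ sg R w F ∷ T → ⊢ sg L w F ∷ T → ⊢ T
cut-admissible (atom n) p q = eliminate (λ { le (idR m) → transfer (≤-∷ m le) q }) p
cut-admissible ⊤ p q = eliminate (λ { le (dec () _) }) q
cut-admissible ⊥ p q = eliminate (λ { le (dec () _) }) p
cut-admissible ⊤* p q = eliminate
  -- Inversion of q leaves the extra atom (ε,w ▷ ε). As w equals `ε` in V, this is up to equality
  -- the atom (ε,ε ▷ ε) that `U` supplies.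
  (λ { le (⊤*R e) → step (U ε) [] λ _ →
         transfer (≤-∷ (⊩-resp (rel ~refl (~-mono (≤-++ʳ _) e) ~refl) (∈⇒⊩ (here refl))) (≤-there le))
                  (invert ⊤*L tt q) })
  p
cut-admissible (F ∧ H) p q = eliminate
  (λ { le (dec ∧R k) → cut-admissible F (k true)
         (cut-admissible H (transfer (≤-swap ≤-refl) (k false))
           (transfer (≤-∷ (∈⇒⊩ (there (here refl))) (≤-swap le)) (invert ∧L tt q))) })
  p
cut-admissible (F ⇒ H) p q = eliminate
  (λ { le (dec ⇒L k) → cut-admissible F (k true)
         (cut-admissible H
           (transfer (≤-∷ (∈⇒⊩ (there (here refl))) (≤-swap le)) (invert ⇒R tt p))
           (transfer (≤-swap ≤-refl) (k false))) })
  q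
cut-admissible (F ✱ H) p q = eliminate
  -- Inversion is taken at the very labels x and y used by `✱R`; since `✱L` has a premise for each
  -- pair of labels, no eigenvariable is renamed.
  (λ { le (✱R {x} {y} m f h) → cut-admissible F f
         (cut-admissible H (transfer (≤-swap ≤-refl) h)
           (transfer (≤-∷ (⊩-mono (≤-there (≤-there ≤-refl)) m)
                       (≤-∷ (∈⇒⊩ (there (here refl))) (≤-swap le)))
             (invert ✱L (x , y) q))) })
  p
cut-admissible (F −✱ H) p q = eliminate
  (λ { le (−✱L {x} {z} m f h) → cut-admissible F f
         (cut-admissible H
           (transfer (≤-∷ (⊩-mono (≤-there (≤-there ≤-refl)) m)
                       (≤-∷ (∈⇒⊩ (there (here refl))) (≤-swap le)))
             (invert −✱R (x , z) p))
           (transfer (≤-swap ≤-refl) h)) })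
  q

-- From LS to the intermediate calculus

left : Item → It
left (fm (w ∶ F)) = sg L w F
left (ra ⟨ x , y ▷ z ⟩) = rel x y z

right : LF → It
right (w ∶ F) = sg R w F

_⊩ˡ[_]_ : Seq → Renaming → Item → Set
S ⊩ˡ[ f ] i = S ⊩ left (renameItem f i)

_⊩ʳ[_]_ : Seq → Renaming → LF → Set
S ⊩ʳ[ f ] j = S ⊩ right (renameLF f j)

record _⊩[_]_⇒_ (S : Seq) (f : Renaming) (Γ : Ante) (Δ : Succ) : Set where
  constructor _&_
  field
    ant : All (S ⊩ˡ[ f ]_) Γ
    succ : All (S ⊩ʳ[ f ]_) Δ
open _⊩[_]_⇒_

⊩-≔ : ∀ {S f n l Γ Δ} → Fresh n Γ Δ → S ⊩[ f ] Γ ⇒ Δ → S ⊩[ f [ n ≔ l ] ] Γ ⇒ Δ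
⊩-≔ {S} {f} {n} {l} {Γ} {Δ} fr (γ & δ) =
  All.zipWith (λ { {i} (p , q) → subst (λ i → S ⊩ left i) (sym (renameItem-≔ f i q)) p })
    (γ , freshItem {n} {Γ} {Δ} fr) &
  All.zipWith (λ { {i} (p , q) → subst (λ j → S ⊩ right j) (sym (renameLF-≔ f i q)) p })
    (δ , freshLF {n} Γ fr)

⊩-weaken : ∀ B {S f Γ Δ} → S ⊩[ f ] Γ ⇒ Δ → (B ++ S) ⊩[ f ] Γ ⇒ Δ
⊩-weaken B (γ & δ) = All.map (⊩-mono (≤-++ʳ B)) γ & All.map (⊩-mono (≤-++ʳ B)) δ

subL-~ : ∀ {S y x} (f : Renaming) → f x ~[ S ] f y → ∀ l → f (subL y x l) ~[ S ] f l
subL-~ {S} {y} {x} f e l with l ≟L x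
... | yes refl = ~sym e
... | no _ = ~refl

All-subA : ∀ {S y x} (f : Renaming) → f x ~[ S ] f y →
  ∀ {Γ} → All (S ⊩ˡ[ f ]_) Γ → All (S ⊩ˡ[ f ]_) (subA y x Γ)
All-subA f e [] = []
All-subA f e {fm (w ∶ F) ∷ _} (p ∷ γ) = ⊩-resp (sg (subL-~ f e w)) p ∷ All-subA f e γ
All-subA f e {ra ⟨ a , b ▷ c ⟩ ∷ _} (p ∷ γ) =
  ⊩-resp (rel (subL-~ f e a) (subL-~ f e b) (subL-~ f e c)) p ∷ All-subA f e γ

All-subS : ∀ {S y x} (f : Renaming) → f x ~[ S ] f y →
  ∀ {Δ} → All (S ⊩ʳ[ f ]_) Δ → All (S ⊩ʳ[ f ]_) (subS y x Δ)
All-subS f e [] = []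
All-subS f e {(w ∶ F) ∷ _} (p ∷ δ) = ⊩-resp (sg (subL-~ f e w)) p ∷ All-subS f e δ

rel-∈ : ∀ {S x y z x' y' z'} → x ≡ x' → y ≡ y' → z ≡ z' → rel x' y' z' ∈ S → S ⊩ rel x y z
rel-∈ refl refl refl = ∈⇒⊩

~refl-≡ : ∀ {S u v} → u ≡ v → u ~[ S ] v
~refl-≡ refl = ~refl

sg-∈ : ∀ {S s w w' F} → w ≡ w' → sg s w' F ∈ S → S ⊩ sg s w F
sg-∈ refl = ∈⇒⊩

-- The interpretation f of labels is general so that an eigenvariable can be sent to whichever label
-- a premise asks for. Rules with a substitution keep f: the two labels involved already have equal
-- values in S.
LS⇒⊢ : ∀ {Γ Δ} → Γ ⊢LS Δ → ∀ f → f ε ≡ ε → ∀ {S} → S ⊩[ f ] Γ ⇒ Δ → ⊢ S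
LS⇒⊢ (exch d p q) f h (γ & δ) = LS⇒⊢ d f h (All-resp-↭ (↭-sym p) γ & All-resp-↭ (↭-sym q) δ)
LS⇒⊢ id f h ((p ∷ γ) & (q ∷ δ)) = step id (q ∷ p ∷ []) λ ()
LS⇒⊢ ⊥L f h ((p ∷ γ) & δ) = step (dec ⊥L _) (p ∷ []) λ ()
LS⇒⊢ ⊤R f h (γ & (q ∷ δ)) = step (dec ⊤R _) (q ∷ []) λ ()
LS⇒⊢ ⊤*R f h {S} (γ & (q ∷ δ)) = step ⊤*R (subst (λ l → S ⊩ sg R l ⊤*) h q ∷ []) λ ()
LS⇒⊢ (cut {Γ} {Γ'} {Δ} {Δ'} {x} {F} d d') f h (γ & δ) with ++⁻ Γ γ | ++⁻ Δ δ
... | γ₁ , γ₂ | δ₁ , δ₂ = cut-admissible F {f x}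
  (LS⇒⊢ d f h (let γ & δ = ⊩-weaken (_ ∷ []) (γ₁ & δ₁) in γ & (∈⇒⊩ (here refl) ∷ δ)))
  (LS⇒⊢ d' f h (let γ & δ = ⊩-weaken (_ ∷ []) (γ₂ & δ₂) in (∈⇒⊩ (here refl) ∷ γ) & δ))
LS⇒⊢ (⊤*L {w = w} w≢ε d) f h {S} ((p ∷ γ) & δ) = step (dec ⊤*L (f w)) (p ∷ []) λ _ →
  let γ & δ = ⊩-weaken (_ ∷ []) (γ & δ)
      e = subst (f w ~[ rel ε (f w) ε ∷ S ]_) (sym h) (~unit (here refl) ~refl)
  in LS⇒⊢ d f h (All-subA f e γ & All-subS f e δ)
LS⇒⊢ (∧L d) f h ((p ∷ γ) & δ) = step (dec ∧L _) (p ∷ []) λ _ →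
  let γ & δ = ⊩-weaken (_ ∷ _ ∷ []) (γ & δ)
  in LS⇒⊢ d f h ((∈⇒⊩ (here refl) ∷ ∈⇒⊩ (there (here refl)) ∷ γ) & δ)
LS⇒⊢ (∧R d d') f h (γ & (q ∷ δ)) = step (dec ∧R _) (q ∷ []) λ where
  true  → let γ & δ = ⊩-weaken (_ ∷ []) (γ & δ) in LS⇒⊢ d f h (γ & (∈⇒⊩ (here refl) ∷ δ))
  false → let γ & δ = ⊩-weaken (_ ∷ []) (γ & δ) in LS⇒⊢ d' f h (γ & (∈⇒⊩ (here refl) ∷ δ))
LS⇒⊢ (⇒L d d') f h ((p ∷ γ) & δ) = step (dec ⇒L _) (p ∷ []) λ where
  true  → let γ & δ = ⊩-weaken (_ ∷ []) (γ & δ) in LS⇒⊢ d f h (γ & (∈⇒⊩ (here refl) ∷ δ))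
  false → let γ & δ = ⊩-weaken (_ ∷ []) (γ & δ) in LS⇒⊢ d' f h ((∈⇒⊩ (here refl) ∷ γ) & δ)
LS⇒⊢ (⇒R d) f h (γ & (q ∷ δ)) = step (dec ⇒R _) (q ∷ []) λ _ →
  let γ & δ = ⊩-weaken (_ ∷ _ ∷ []) (γ & δ)
  in LS⇒⊢ d f h ((∈⇒⊩ (here refl) ∷ γ) & (∈⇒⊩ (there (here refl)) ∷ δ))
LS⇒⊢ (✱L {Γ} {Δ} {z} {F} {H} x y x≢y frx fry d) f h σ@((p ∷ _) & _) =
  step (dec ✱L (f z)) (p ∷ []) λ { (k , l) →
    let f' = f [ x ≔ k ]
        g  = f' [ y ≔ l ]
        gx = trans (≔-other f' {y} {l} (var x) (λ { refl → x≢y refl })) (≔-same f x k)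
        gy = ≔-same f' y l
        gz = trans (≔-other f' {y} {l} z (λ { refl → fry (here refl) }))
                   (≔-other f {x} {k} z (λ { refl → frx (here refl) }))
        σ' = ⊩-weaken (_ ∷ _ ∷ _ ∷ []) (⊩-≔ {n = y} {l = l} fry (⊩-≔ {n = x} {l = k} frx σ))
    in LS⇒⊢ d g h
         ((rel-∈ gx gy gz (here refl) ∷ sg-∈ gx (there (here refl)) ∷
           sg-∈ gy (there (there (here refl))) ∷ All.tail (ant σ')) & succ σ') }
LS⇒⊢ (−✱R {Γ} {Δ} {y} {F} {H} x z x≢z frx frz d) f h σ@(_ & (q ∷ _)) =
  step (dec −✱R (f y)) (q ∷ []) λ { (k , l) →
    let f' = f [ x ≔ k ]
        g  = f' [ z ≔ l ]
        gx = trans (≔-other f' {z} {l} (var x) (λ { refl → x≢z refl })) (≔-same f x k)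
        gz = ≔-same f' z l
        gy = trans (≔-other f' {z} {l} y (λ { refl → frz (∈-++⁺ʳ (concatMap labsItem Γ) (here refl)) }))
                   (≔-other f {x} {k} y (λ { refl → frx (∈-++⁺ʳ (concatMap labsItem Γ) (here refl)) }))
        σ' = ⊩-weaken (_ ∷ _ ∷ _ ∷ []) (⊩-≔ {n = z} {l = l} frz (⊩-≔ {n = x} {l = k} frx σ))
    in LS⇒⊢ d g h
         ((rel-∈ gx gy gz (here refl) ∷ sg-∈ gx (there (here refl)) ∷ ant σ') &
          (sg-∈ gz (there (there (here refl))) ∷ All.tail (succ σ'))) }
LS⇒⊢ (✱R d d') f h (γ & (q ∷ δ)) = step ✱R (q ∷ All.head γ ∷ []) λ where
  true  → let γ & δ = ⊩-weaken (_ ∷ []) (γ & (q ∷ δ)) in LS⇒⊢ d f h (γ & (∈⇒⊩ (here refl) ∷ δ))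
  false → let γ & δ = ⊩-weaken (_ ∷ []) (γ & (q ∷ δ)) in LS⇒⊢ d' f h (γ & (∈⇒⊩ (here refl) ∷ δ))
LS⇒⊢ (−✱L d d') f h σ@((p ∷ q ∷ γ) & δ) = step −✱L (q ∷ p ∷ []) λ where
  true  → let γ & δ = ⊩-weaken (_ ∷ []) σ in LS⇒⊢ d f h (γ & (∈⇒⊩ (here refl) ∷ δ))
  false → let γ & δ = ⊩-weaken (_ ∷ []) σ
          in LS⇒⊢ d' f h ((All.head γ ∷ All.head (All.tail γ) ∷ ∈⇒⊩ (here refl) ∷ All.tail (All.tail γ)) & δ)
LS⇒⊢ (E d) f h σ@((p ∷ _) & _) = step E (p ∷ []) λ _ →
  let γ & δ = ⊩-weaken (_ ∷ []) σ in LS⇒⊢ d f h ((∈⇒⊩ (here refl) ∷ γ) & δ)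
LS⇒⊢ (U {x = x} d) f h σ = step (U (f x)) [] λ _ →
  let γ & δ = ⊩-weaken (_ ∷ []) σ in LS⇒⊢ d f h ((rel-∈ refl h refl (here refl) ∷ γ) & δ)
LS⇒⊢ (A {x = x} {y} {z} {u} {v} w fr d) f h σ@((p ∷ q ∷ _) & _) = step A (p ∷ q ∷ []) λ k →
  let gw = ≔-same f w k
      gu = ≔-other f {w} {k} u (λ { refl → fr (there (there (there (here refl)))) })
      gz = ≔-other f {w} {k} z (λ { refl → fr (there (there (here refl))) })
      gy = ≔-other f {w} {k} y (λ { refl → fr (there (here refl)) })
      gv = ≔-other f {w} {k} v (λ { refl → fr (there (there (there (there (here refl))))) })
      γ & δ = ⊩-weaken (_ ∷ _ ∷ []) (⊩-≔ {n = w} {l = k} fr σ)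
  in LS⇒⊢ d (f [ w ≔ k ]) h
       ((rel-∈ gu gw gz (here refl) ∷ rel-∈ gy gv gw (there (here refl)) ∷ γ) & δ)
LS⇒⊢ (AC {x = x} {y} w fr d) f h σ@((p ∷ _) & _) = step A (p ∷ p ∷ []) λ k →
  let gw = ≔-same f w k
      gx = ≔-other f {w} {k} x (λ { refl → fr (here refl) })
      gy = ≔-other f {w} {k} y (λ { refl → fr (there (here refl)) })
      γ & δ = ⊩-weaken (_ ∷ _ ∷ []) (⊩-≔ {n = w} {l = k} fr σ)
  in LS⇒⊢ d (f [ w ≔ k ]) h
       ((rel-∈ gx gw gx (here refl) ∷ rel-∈ gy gy gw (there (here refl)) ∷ γ) & δ)
LS⇒⊢ (Eq₁ {w = w} {w'} _ d) f h {S} ((p ∷ γ) & δ) =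
  let p' = subst (λ l → S ⊩ rel l (f w) (f w')) h p
      e  = ~-unit p' ~refl
  in LS⇒⊢ d f h ((⊩-resp (rel (~refl-≡ h) (~sym e) ~refl) p' ∷ All-subA f e γ) & All-subS f e δ)
LS⇒⊢ (Eq₂ {w = w} {w'} _ d) f h {S} ((p ∷ γ) & δ) =
  let p' = subst (λ l → S ⊩ rel l (f w') (f w)) h p
      e  = ~sym (~-unit p' ~refl)
  in LS⇒⊢ d f h ((⊩-resp (rel (~refl-≡ h) ~refl (~sym e)) p' ∷ All-subA f e γ) & All-subS f e δ)

-- Equality entailment is closed under renaming, transitivity and the unit law

subRA-invariant : ∀ (f : Renaming) {x y} → f x ≡ f y → ∀ r → renameRA f (subRA y x r) ≡ renameRA f r
subRA-invariant f e ⟨ a , b ▷ c ⟩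
  rewrite subL-invariant f e a | subL-invariant f e b | subL-invariant f e c = refl

_⊆[_]_ : List RA → Renaming → List RA → Set
G ⊆[ f ] H = ∀ {r} → r ∈ G → renameRA f r ∈ H

⊆-subG : ∀ {H y x r} → H ⊆[ subL y x ] (r ∷ subG y x H)
⊆-subG {y = y} {x} {_} {⟨ _ , _ ▷ _ ⟩} m = there (∈-map⁺ (subRA y x) m)

⊆-id : ∀ {H} → H ⊆[ (λ l → l) ] H
⊆-id {r = ⟨ _ , _ ▷ _ ⟩} m = m

-- Uses whichever Eq instance applies, or none when both labels are `ε`. The continuation sees only
-- that a and b have been identified, so callers need not follow the direction of the substitution.
≐-step : ∀ {H u v a b} → ⟨ ε , a ▷ b ⟩ ∈ H →
  (∀ g → g ε ≡ ε → g a ≡ g b → ∀ {H'} → H ⊆[ g ] H' → H' ⊢E g u ≐ g v) → H ⊢E u ≐ v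
≐-step {H} {u} {v} {a} {b} m k with a ≟L ε | b ≟L ε
... | no a≢ε | _ = E-eq₁ m a≢ε (k (subL b a) (subL-ε a≢ε)
        (trans (subL-self b a) (sym (subL-target b a))) ⊆-subG)
... | yes refl | no b≢ε = E-eq₂ m b≢ε
        (k (subL ε b) (subL-ε b≢ε) (trans (subL-target ε b) (sym (subL-self ε b))) ⊆-subG)
... | yes refl | yes refl = k (λ l → l) refl refl {H} ⊆-id

⊆-merge : ∀ {G H w w'} (f : Renaming) → f w ≡ f w' → ⟨ f ε , f w' ▷ f w' ⟩ ∈ H →
  G ⊆[ f ] H → (⟨ ε , w' ▷ w' ⟩ ∷ subG w' w G) ⊆[ f ] H
⊆-merge f e m s (here refl) = m
⊆-merge {H = H} {w} {w'} f e m s (there n) with ∈-map⁻ (subRA w' w) n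
... | r , n' , refl = subst (_∈ H) (sym (subRA-invariant f e r)) (s n')

⊆-∘ : ∀ {G H J} {f g : Renaming} → G ⊆[ f ] H → H ⊆[ g ] J → G ⊆[ (g ∘ f) ] J
⊆-∘ p q {⟨ _ , _ ▷ _ ⟩} m = q (p m)

-- Each instance is replayed on the image of its principal atom by `≐-step`. The composite g ∘ f
-- then identifies w and w', hence absorbs the substitution of the instance, and the induction
-- continues with g ∘ f.
≐-rename : ∀ {G u v} → G ⊢E u ≐ v → ∀ f → f ε ≡ ε → ∀ {H} → G ⊆[ f ] H → H ⊢E f u ≐ f v
≐-rename E-done f h s = E-done
≐-rename (E-eq₁ {u} {v} {w} {w'} m w≢ε d) f h {H} s =
  ≐-step (subst (λ l → ⟨ l , f w ▷ f w' ⟩ ∈ H) h (s m)) λ g gε e {H'} s' →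
    let inv = subL-invariant (g ∘ f) e
        gf  = ⊆-∘ s s'
        m'  = subst (λ l → ⟨ g (f ε) , l ▷ g (f w') ⟩ ∈ H') e (gf m)
    in subst₂ (H' ⊢E_≐_) (inv u) (inv v)
         (≐-rename d (g ∘ f) (trans (cong g h) gε) (⊆-merge (g ∘ f) e m' gf))
≐-rename (E-eq₂ {u} {v} {w} {w'} m w≢ε d) f h {H} s =
  ≐-step (subst (λ l → ⟨ l , f w' ▷ f w ⟩ ∈ H) h (s m)) λ g gε e {H'} s' →
    let inv = subL-invariant (g ∘ f) (sym e)
        gf  = ⊆-∘ s s'
        m'  = subst (λ l → ⟨ g (f ε) , g (f w') ▷ l ⟩ ∈ H') (sym e) (gf m)
    in subst₂ (H' ⊢E_≐_) (inv u) (inv v)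
         (≐-rename d (g ∘ f) (trans (cong g h) gε) (⊆-merge (g ∘ f) (sym e) m' gf))

≐-mono : ∀ {G H u v} → (∀ {r} → r ∈ G → r ∈ H) → G ⊢E u ≐ v → H ⊢E u ≐ v
≐-mono s d = ≐-rename d (λ l → l) refl (⊆-id ∘ s)

≐-sym : ∀ {G u v} → G ⊢E u ≐ v → G ⊢E v ≐ u
≐-sym E-done = E-done
≐-sym (E-eq₁ m n d) = E-eq₁ m n (≐-sym d)
≐-sym (E-eq₂ m n d) = E-eq₂ m n (≐-sym d)

≐-trans : ∀ {G u v w} → G ⊢E u ≐ v → G ⊢E v ≐ w → G ⊢E u ≐ w
≐-trans E-done q = q
≐-trans (E-eq₁ m n d) q = E-eq₁ m n (≐-trans d (≐-rename q _ (subL-ε n) ⊆-subG))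
≐-trans (E-eq₂ m n d) q = E-eq₂ m n (≐-trans d (≐-rename q _ (subL-ε n) ⊆-subG))

-- The derivation is run until a has literally become `ε`; the image of the atom is then principal.
-- The label b is separate from `ε` because a substitution returns `ε` only propositionally.
≐-unit : ∀ {G a b u v} → G ⊢E a ≐ b → b ≡ ε → ⟨ a , u ▷ v ⟩ ∈ G → G ⊢E u ≐ v
≐-unit {u = u} E-done refl m = ≐-step m λ { g _ e {H'} _ → subst (H' ⊢E g u ≐_) e E-done }
≐-unit (E-eq₁ n w≢ε d) refl m = E-eq₁ n w≢ε (≐-unit d (subL-ε w≢ε) (⊆-subG m))
≐-unit (E-eq₂ n w≢ε d) refl m = E-eq₂ n w≢ε (≐-unit d (subL-ε w≢ε) (⊆-subG m))

-- From the intermediate calculus to ILS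

seq : Ante → Succ → Seq
seq Γ Δ = map left Γ ++ map right Δ

ra-∈-rels : ∀ {r Γ} → ra r ∈ Γ → r ∈ rels Γ
ra-∈-rels (here refl) = here refl
ra-∈-rels {Γ = fm _ ∷ _} (there m) = ra-∈-rels m
ra-∈-rels {Γ = ra _ ∷ _} (there m) = there (ra-∈-rels m)

rels-∈-ra : ∀ {r Γ} → r ∈ rels Γ → ra r ∈ Γ
rels-∈-ra {Γ = fm _ ∷ Γ} m = there (rels-∈-ra m)
rels-∈-ra {Γ = ra _ ∷ Γ} (here refl) = here refl
rels-∈-ra {Γ = ra _ ∷ Γ} (there m) = there (rels-∈-ra m)

rels-↭ : ∀ {Γ Γ' r} → Γ ↭ Γ' → r ∈ rels Γ → r ∈ rels Γ'
rels-↭ π m = ra-∈-rels (∈-resp-↭ π (rels-∈-ra m))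

left⁻ : ∀ {Γ Δ w F} → sg L w F ∈ seq Γ Δ → fm (w ∶ F) ∈ Γ
left⁻ {Γ} m with ∈-++⁻ (map left Γ) m
... | inj₁ n with ∈-map⁻ left n
...   | fm (_ ∶ _) , n' , refl = n'
...   | ra ⟨ _ , _ ▷ _ ⟩ , n' , ()
left⁻ {Γ} m | inj₂ n with ∈-map⁻ right n
...   | (_ ∶ _) , _ , ()

right⁻ : ∀ Γ {Δ w F} → sg R w F ∈ seq Γ Δ → (w ∶ F) ∈ Δ
right⁻ Γ m with ∈-++⁻ (map left Γ) m
... | inj₁ n with ∈-map⁻ left n
...   | fm (_ ∶ _) , _ , ()
...   | ra ⟨ _ , _ ▷ _ ⟩ , _ , ()
right⁻ Γ m | inj₂ n with ∈-map⁻ right n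
...   | (_ ∶ _) , n' , refl = n'

rel⁻ : ∀ {Γ Δ x y z} → rel x y z ∈ seq Γ Δ → ra ⟨ x , y ▷ z ⟩ ∈ Γ
rel⁻ {Γ} m with ∈-++⁻ (map left Γ) m
... | inj₁ n with ∈-map⁻ left n
...   | fm (_ ∶ _) , _ , ()
...   | ra ⟨ _ , _ ▷ _ ⟩ , n' , refl = n'
rel⁻ {Γ} m | inj₂ n with ∈-map⁻ right n
...   | (_ ∶ _) , _ , ()

~⇒≐ : ∀ Γ Δ {u v} → u ~[ seq Γ Δ ] v → rels Γ ⊢E u ≐ v
~⇒≐ Γ Δ ~refl        = E-done
~⇒≐ Γ Δ (~sym p)     = ≐-sym (~⇒≐ Γ Δ p)
~⇒≐ Γ Δ (~trans p q) = ≐-trans (~⇒≐ Γ Δ p) (~⇒≐ Γ Δ q)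
~⇒≐ Γ Δ (~unit m e)  = ≐-unit (~⇒≐ Γ Δ e) refl (ra-∈-rels (rel⁻ {Γ} m))

front : ∀ {X : Set} {x : X} {xs} → x ∈ xs → ∃[ ys ] x ∷ ys ↭ xs
front m with ∈-∃++ m
... | ys , zs , refl = ys ++ zs , ↭-sym (shift _ ys zs)

left-∈ : ∀ {Γ Δ i} → i ∈ Γ → left i ∈ seq Γ Δ
left-∈ m = ∈-++⁺ˡ (∈-map⁺ left m)

right-∈ : ∀ Γ {Δ j} → j ∈ Δ → right j ∈ seq Γ Δ
right-∈ Γ m = ∈-++⁺ʳ (map left Γ) (∈-map⁺ right m)

Replaces : It → Ante → Succ → Ante → Succ → Set
Replaces a Γ Δ Γ' Δ' = ∀ {b} → b ∈ seq Γ Δ → b ≡ a ⊎ b ∈ seq Γ' Δ'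

replaceˡ : ∀ {i Γ₀ Γ Δ Γ' Δ'} → i ∷ Γ₀ ↭ Γ → (∀ {j} → j ∈ Γ₀ → j ∈ Γ') → (∀ {j} → j ∈ Δ → j ∈ Δ') →
  Replaces (left i) Γ Δ Γ' Δ'
replaceˡ {Γ = Γ} {Γ' = Γ'} π s t m with ∈-++⁻ (map left Γ) m
... | inj₂ n with ∈-map⁻ right n
...   | _ , n' , refl = inj₂ (right-∈ Γ' (t n'))
replaceˡ {Γ = Γ} π s t m | inj₁ n with ∈-map⁻ left n
...   | _ , n' , refl with ∈-resp-↭ (↭-sym π) n'
...     | here refl = inj₁ refl
...     | there n'' = inj₂ (left-∈ (s n''))

replaceʳ : ∀ {j Γ Δ₀ Δ Γ' Δ'} → j ∷ Δ₀ ↭ Δ → (∀ {i} → i ∈ Γ → i ∈ Γ') → (∀ {i} → i ∈ Δ₀ → i ∈ Δ') →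
  Replaces (right j) Γ Δ Γ' Δ'
replaceʳ {Γ = Γ} {Γ' = Γ'} π s t m with ∈-++⁻ (map left Γ) m
... | inj₁ n with ∈-map⁻ left n
...   | _ , n' , refl = inj₂ (left-∈ (s n'))
replaceʳ {Γ = Γ} {Γ' = Γ'} π s t m | inj₂ n with ∈-map⁻ right n
...   | _ , n' , refl with ∈-resp-↭ (↭-sym π) n'
...     | here refl = inj₁ refl
...     | there n'' = inj₂ (right-∈ Γ' (t n''))

exchˡ : ∀ {Γ Γ' Δ} → Γ ↭ Γ' → Γ ⊢ILS Δ → Γ' ⊢ILS Δ
exchˡ π d = exch d π ↭-refl

exchʳ : ∀ {Γ Δ Δ'} → Δ ↭ Δ' → Γ ⊢ILS Δ → Γ ⊢ILS Δ'
exchʳ π d = exch d ↭-refl π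

-- Premises are described only by what they gain and by the one item they may lose, so that the nine
-- rules can be handled alike afterwards. Eigenvariables are chosen fresh here.
decompose : ∀ {s F w Γ Δ} (d : Decomp s F) → sg s w F ∈ seq Γ Δ →
  (∀ i Γ' Δ' → All (_∈ seq Γ' Δ') (parts d w i) → Replaces (sg s w F) Γ Δ Γ' Δ' → Γ' ⊢ILS Δ') →
  Γ ⊢ILS Δ
decompose {Γ = Γ} ⊥L m k with front (left⁻ {Γ} m)
... | _ , π = exchˡ π ⊥L
decompose {Γ = Γ} ⊤R m k with front (right⁻ Γ m)
... | _ , π = exchʳ π ⊤R
decompose {Γ = Γ} ⊤*L m k with front (left⁻ {Γ} m)
... | _ , π = exchˡ π (⊤*L (k tt _ _ (here refl ∷ []) (replaceˡ π there id→)))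
decompose {Γ = Γ} ∧L m k with front (left⁻ {Γ} m)
... | _ , π = exchˡ π (∧L (k tt _ _ (here refl ∷ there (here refl) ∷ [])
  (replaceˡ π (there ∘ there) id→)))
decompose {Γ = Γ} ∧R m k with front (right⁻ Γ m)
... | _ , π = exchʳ π (∧R
  (k true _ _ (right-∈ Γ (here refl) ∷ []) (replaceʳ π id→ there))
  (k false _ _ (right-∈ Γ (here refl) ∷ []) (replaceʳ π id→ there)))
decompose {Γ = Γ} ⇒L m k with front (left⁻ {Γ} m)
... | Γ₀ , π = exchˡ π (⇒L
  (k true _ _ (right-∈ Γ₀ (here refl) ∷ []) (replaceˡ π id→ there))
  (k false _ _ (here refl ∷ []) (replaceˡ π there id→)))
decompose {Γ = Γ} ⇒R m k with front (right⁻ Γ m)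
... | _ , π = exchʳ π (⇒R (k tt _ _ (here refl ∷ right-∈ (_ ∷ Γ) (here refl) ∷ [])
  (replaceʳ π there there)))
decompose {Γ = Γ} {Δ} (✱L {F} {H}) m k with front (left⁻ {Γ} m)
... | Γ₀ , π with fresh₂ (labels (fm (_ ∶ F ✱ H) ∷ Γ₀) Δ)
...   | x , y , x≢y , frx , fry = exchˡ π (✱L x y x≢y frx fry
  (k (var x , var y) _ _ (here refl ∷ there (here refl) ∷ there (there (here refl)) ∷ [])
    (replaceˡ π (there ∘ there ∘ there) id→)))
decompose {Γ = Γ} (−✱R {F} {H}) m k with front (right⁻ Γ m)
... | Δ₀ , π with fresh₂ (labels Γ ((_ ∶ F −✱ H) ∷ Δ₀))
...   | x , z , x≢z , frx , frz = exchʳ π (−✱R x z x≢z frx frz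
  (k (var x , var z) _ _ (here refl ∷ there (here refl) ∷ right-∈ (_ ∷ _ ∷ Γ) (here refl) ∷ [])
    (replaceʳ π (there ∘ there) there)))

-- ILS discards principal formulas that ⊢_ keeps, so an item of S need not occur in the ILS sequent C:
-- it may have been replaced by the parts of one of its premises. This spares a proof of contraction in ILS.
data Covered (C : Seq) : It → Set where
  present : ∀ {a} → C ⊩ a → Covered C a
  split   : ∀ {s F w w'} (d : Decomp s F) i → w ~[ C ] w' → All (Covered C) (parts d w' i) →
            Covered C (sg s w F)

Covered-resp : ∀ {C a b} → a ≈[ C ] b → Covered C b → Covered C a
Covered-resp e (present m) = present (⊩-resp e m)
Covered-resp (sg e) (split d i e' ps) = split d i (~trans e e') ps

Covered-Pointwise : ∀ {C as bs} → Pointwise (_≈[ C ]_) as bs → All (Covered C) bs → All (Covered C) as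
Covered-Pointwise [] [] = []
Covered-Pointwise (e ∷ es) (p ∷ ps) = Covered-resp e p ∷ Covered-Pointwise es ps

Covered-rel : ∀ {C x y z} → Covered C (rel x y z) → C ⊩ rel x y z
Covered-rel (present m) = m

Covers : Seq → Seq → Set
Covers C S = ∀ {a} → a ∈ S → Covered C a

-- Only signed formulae are ever `split`; relational atoms stay present up to equality, and with
-- them all equations.
Covers-~ : ∀ {C S} → Covers C S → ∀ {u v} → u ~[ S ] v → u ~[ C ] v
Covers-~ c ~refl        = ~refl
Covers-~ c (~sym p)     = ~sym (Covers-~ c p)
Covers-~ c (~trans p q) = ~trans (Covers-~ c p) (Covers-~ c q)
Covers-~ c (~unit m e)  = ~-unit (Covered-rel (c m)) (Covers-~ c e)

Covers-⊩ : ∀ {C S} → Covers C S → ∀ {a} → S ⊩ a → Covered C a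
Covers-⊩ c (_ , m , e) = Covered-resp (≈-map (Covers-~ c) e) (c m)

Covers-++ : ∀ {C B S} → All (Covered C) B → Covers C S → Covers C (B ++ S)
Covers-++ {B = B} p c m with ∈-++⁻ B m
... | inj₁ n = All.lookup p n
... | inj₂ n = c n

mutual
  Covered-trans : ∀ {C D} → Covers D C → ∀ {a} → Covered C a → Covered D a
  Covered-trans c (present m) = Covers-⊩ c m
  Covered-trans c (split d i e ps) = split d i (Covers-~ c e) (All-Covered-trans c ps)

  All-Covered-trans : ∀ {C D} → Covers D C → ∀ {as} → All (Covered C) as → All (Covered D) as
  All-Covered-trans c [] = []
  All-Covered-trans c (p ∷ ps) = Covered-trans c p ∷ All-Covered-trans c ps

seq-Covers : ∀ {Γ Δ Γ' Δ'} → (∀ {i} → i ∈ Γ → i ∈ Γ') → (∀ {j} → j ∈ Δ → j ∈ Δ') →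
  Covers (seq Γ' Δ') (seq Γ Δ)
seq-Covers {Γ} {Γ' = Γ'} s t m with ∈-++⁻ (map left Γ) m
... | inj₁ n with ∈-map⁻ left n
...   | _ , n' , refl = present (∈⇒⊩ (left-∈ (s n')))
seq-Covers {Γ} {Γ' = Γ'} s t m | inj₂ n with ∈-map⁻ right n
...   | _ , n' , refl = present (∈⇒⊩ (right-∈ Γ' (t n')))

front₂ : ∀ {X : Set} {x y : X} {xs} → x ∈ xs → y ∈ xs → x ≡ y ⊎ (∃[ zs ] x ∷ y ∷ zs ↭ xs)
front₂ m n with front m
... | ys , π with ∈-resp-↭ (↭-sym π) n
...   | here refl = inj₁ refl
...   | there n' with front n'
...     | zs , ρ = inj₂ (zs , ↭-trans (prep _ ρ) π)

≐-front : ∀ {Γ Γ' Δ u v} → Γ' ↭ Γ → u ~[ seq Γ Δ ] v → rels Γ' ⊢E u ≐ v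
≐-front {Γ} {Γ'} {Δ} π e = ≐-mono (rels-↭ (↭-sym π)) (~⇒≐ Γ Δ e)

insert₃ : ∀ {X : Set} {a b c x : X} {xs} → x ∈ a ∷ b ∷ xs → x ∈ a ∷ b ∷ c ∷ xs
insert₃ (here e) = here e
insert₃ (there (here e)) = there (here e)
insert₃ (there (there m)) = there (there (there m))

premise : ∀ {C as} →
  (∀ Γ' Δ' → All (Covered (seq Γ' Δ')) as → Covers (seq Γ' Δ') C → Γ' ⊢ILS Δ') →
  ∀ {bs Γ' Δ'} → Pointwise (_≈[ C ]_) as bs → All (_∈ seq Γ' Δ') bs →
  Covers (seq Γ' Δ') C → Γ' ⊢ILS Δ'
premise k es new c = k _ _
  (Covered-Pointwise (Pointwise.map (≈-map (Covers-~ c)) es) (All.map (present ∘ ∈⇒⊩) new)) c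

⊢⇒ILS : ∀ {S} → ⊢ S → ∀ Γ Δ → Covers (seq Γ Δ) S → Γ ⊢ILS Δ
⊢⇒ILS (step r ps k) Γ Δ c = go r (All.map (Covers-⊩ c) ps) λ i Γ' Δ' p c' →
    ⊢⇒ILS (k i) Γ' Δ' (Covers-++ p (Covered-trans c' ∘ c))
  where
  premise-⊆ : ∀ {as bs Γ' Δ'} →
    (∀ Γ' Δ' → All (Covered (seq Γ' Δ')) as → Covers (seq Γ' Δ') (seq Γ Δ) → Γ' ⊢ILS Δ') →
    Pointwise (_≈[ seq Γ Δ ]_) as bs → All (_∈ seq Γ' Δ') bs →
    (∀ {i} → i ∈ Γ → i ∈ Γ') → (∀ {j} → j ∈ Δ → j ∈ Δ') → Γ' ⊢ILS Δ'
  premise-⊆ {Γ' = Γ'} {Δ'} k es new s t = premise k es new (seq-Covers {Γ} {Δ} {Γ'} {Δ'} s t)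

  go : ∀ {ps} (r : Rule ps) → All (Covered (seq Γ Δ)) ps →
    (∀ i Γ' Δ' → All (Covered (seq Γ' Δ')) (adds r i) → Covers (seq Γ' Δ') (seq Γ Δ) → Γ' ⊢ILS Δ') →
    Γ ⊢ILS Δ
  -- The formula was decomposed earlier and the parts of its i-th premise are covered, so the i-th
  -- premise of this step suffices and no ILS rule is applied.
  go (dec d w) (split d' i e p ∷ []) k with Decomp-unique d d'
  ... | refl = k i Γ Δ (Covered-Pointwise (parts-≈ d i e) p) (present ∘ ∈⇒⊩)
  go (dec d w) (present (_ , m , sg e) ∷ []) k =
    decompose d m λ i Γ' Δ' new old →
      premise (k i) (parts-≈ d i e) new λ n → Sum.[
        (λ { refl → split d i ~refl (All.map (present ∘ ∈⇒⊩) new) }) , present ∘ ∈⇒⊩ ] (old n)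
  -- From here on the principal formulae have no `Decomp` on their side, so they cannot have been
  -- split.
  go id (present (_ , m , sg e) ∷ present (_ , n , sg e') ∷ []) k
    with front (right⁻ Γ m) | front (left⁻ {Γ} n)
  ... | _ , ρ | _ , π = exchˡ π (exchʳ ρ (id (≐-front {Δ = Δ} π (~trans (~sym e') e))))
  go ⊤*R (present (_ , m , sg e) ∷ []) k with front (right⁻ Γ m)
  ... | _ , ρ = exchʳ ρ (⊤*R (~⇒≐ Γ Δ (~sym e)))
  go ✱R (present (_ , m , sg e) ∷ present (_ , n , rel ex ey ez) ∷ []) k
    with front (right⁻ Γ m) | front (rel⁻ {Γ} n)
  ... | _ , ρ | Γ₀ , π = exchˡ π (exchʳ ρ (✱R (≐-front {Δ = Δ} π (~trans (~sym e) ez))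
      (premise-⊆ (k true) (sg ex ∷ []) (right-∈ (_ ∷ Γ₀) (here refl) ∷ [])
        (∈-resp-↭ (↭-sym π)) (there ∘ ∈-resp-↭ (↭-sym ρ)))
      (premise-⊆ (k false) (sg ey ∷ []) (right-∈ (_ ∷ Γ₀) (here refl) ∷ [])
        (∈-resp-↭ (↭-sym π)) (there ∘ ∈-resp-↭ (↭-sym ρ)))))
  go −✱L (present (_ , m , sg e) ∷ present (_ , n , rel ex ey ez) ∷ []) k
    with front₂ (rel⁻ {Γ} n) (left⁻ {Γ} m)
  ... | inj₂ (Γ₀ , π) = exchˡ π (−✱L (≐-front {Δ = Δ} π (~trans (~sym e) ey))
      (premise-⊆ (k true) (sg ex ∷ []) (right-∈ (_ ∷ _ ∷ Γ₀) (here refl) ∷ [])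
        (∈-resp-↭ (↭-sym π)) there)
      (premise-⊆ (k false) (sg ez ∷ []) (there (there (here refl)) ∷ [])
        (insert₃ ∘ ∈-resp-↭ (↭-sym π)) id→))
  go E (present (_ , m , rel ex ey ez) ∷ []) k with front (rel⁻ {Γ} m)
  ... | _ , π = exchˡ π (E (premise-⊆ (k tt) (rel ey ex ez ∷ []) (here refl ∷ [])
      (there ∘ ∈-resp-↭ (↭-sym π)) id→))
  go (U x) [] k = U (premise-⊆ (k tt) (≈-refl ∷ []) (here refl ∷ []) there id→)
  go A (present (_ , m , rel ex ey ez) ∷ present (_ , n , rel eu ev ex') ∷ []) k
    with front₂ (rel⁻ {Γ} m) (rel⁻ {Γ} n)
  ... | inj₂ (Γ₀ , π) with fresh (labels (ra ⟨ _ , _ ▷ _ ⟩ ∷ ra ⟨ _ , _ ▷ _ ⟩ ∷ Γ₀) Δ)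
  ...   | w , fr = exchˡ π (A w (≐-front {Δ = Δ} π (~trans (~sym ex) ex')) fr
      (premise-⊆ (k (var w)) (rel eu ~refl ez ∷ rel ey ev ~refl ∷ []) (here refl ∷ there (here refl) ∷ [])
        (there ∘ there ∘ ∈-resp-↭ (↭-sym π)) id→))
  -- Both items are matched by a single occurrence of an atom, which is the situation of `AC`.
  go A (present (_ , m , rel ex ey ez) ∷ present (_ , n , rel eu ev ex') ∷ []) k
      | inj₁ refl with front (rel⁻ {Γ} m)
  ... | Γ₀ , π with fresh (labels (ra ⟨ _ , _ ▷ _ ⟩ ∷ Γ₀) Δ)
  ...   | w , fr = exchˡ π (AC w (≐-front {Δ = Δ} π (~trans (~sym ex) ex')) fr
      (premise-⊆ (k (var w)) (rel eu ~refl ez ∷ rel ey ev ~refl ∷ []) (here refl ∷ there (here refl) ∷ [])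
        (there ∘ there ∘ ∈-resp-↭ (↭-sym π)) id→))

-- Renaming and weakening in LS

renA : Renaming → Ante → Ante
renA f = map (renameItem f)

renS : Renaming → Succ → Succ
renS f = map (renameLF f)

renameItem-cong : ∀ {f g : Renaming} → (∀ l → f l ≡ g l) → ∀ i → renameItem f i ≡ renameItem g i
renameItem-cong e (fm (w ∶ F)) rewrite e w = refl
renameItem-cong e (ra ⟨ x , y ▷ z ⟩) rewrite e x | e y | e z = refl

renameLF-cong : ∀ {f g : Renaming} → (∀ l → f l ≡ g l) → ∀ j → renameLF f j ≡ renameLF g j
renameLF-cong e (w ∶ F) rewrite e w = refl

renameItem-id : ∀ i → renameItem id→ i ≡ i
renameItem-id (fm (w ∶ F)) = refl
renameItem-id (ra ⟨ x , y ▷ z ⟩) = refl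

renameLF-id : ∀ j → renameLF id→ j ≡ j
renameLF-id (w ∶ F) = refl

renameItem-∘ : ∀ g f i → renameItem g (renameItem f i) ≡ renameItem (g ∘ f) i
renameItem-∘ g f (fm (w ∶ F)) = refl
renameItem-∘ g f (ra ⟨ x , y ▷ z ⟩) = refl

renameLF-∘ : ∀ g f j → renameLF g (renameLF f j) ≡ renameLF (g ∘ f) j
renameLF-∘ g f (w ∶ F) = refl

subItem≡renameItem : ∀ y x i → subItem y x i ≡ renameItem (subL y x) i
subItem≡renameItem y x (fm (w ∶ F)) = refl
subItem≡renameItem y x (ra ⟨ _ , _ ▷ _ ⟩) = refl

subLF≡renameLF : ∀ y x j → subLF y x j ≡ renameLF (subL y x) j
subLF≡renameLF y x (w ∶ F) = refl

renA-id : ∀ Γ → renA id→ Γ ≡ Γ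
renA-id Γ = trans (map-cong renameItem-id Γ) (map-id Γ)

renS-id : ∀ Δ → renS id→ Δ ≡ Δ
renS-id Δ = trans (map-cong renameLF-id Δ) (map-id Δ)

renA-∘ : ∀ g f Γ → renA g (renA f Γ) ≡ renA (g ∘ f) Γ
renA-∘ g f Γ = trans (sym (map-∘ Γ)) (map-cong (renameItem-∘ g f) Γ)

renS-∘ : ∀ g f Δ → renS g (renS f Δ) ≡ renS (g ∘ f) Δ
renS-∘ g f Δ = trans (sym (map-∘ Δ)) (map-cong (renameLF-∘ g f) Δ)

subA≡renA : ∀ y x Γ → subA y x Γ ≡ renA (subL y x) Γ
subA≡renA y x = map-cong (subItem≡renameItem y x)

subS≡renS : ∀ y x Δ → subS y x Δ ≡ renS (subL y x) Δ
subS≡renS y x = map-cong (subLF≡renameLF y x)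

renA-subA : ∀ (f : Renaming) {x y} → f x ≡ f y → ∀ Γ → renA f (subA y x Γ) ≡ renA f Γ
renA-subA f {x} {y} e Γ = trans (cong (renA f) (subA≡renA y x Γ))
  (trans (renA-∘ f (subL y x) Γ) (map-cong (renameItem-cong (subL-invariant f e)) Γ))

renS-subS : ∀ (f : Renaming) {x y} → f x ≡ f y → ∀ Δ → renS f (subS y x Δ) ≡ renS f Δ
renS-subS f {x} {y} e Δ = trans (cong (renS f) (subS≡renS y x Δ))
  (trans (renS-∘ f (subL y x) Δ) (map-cong (renameLF-cong (subL-invariant f e)) Δ))

renA-≔ : ∀ {f n l Γ} Δ → Fresh n Γ Δ → renA (f [ n ≔ l ]) Γ ≡ renA f Γ
renA-≔ {f} {n} {l} {Γ} Δ fr = map-cong-local (All.map (renameItem-≔ f _) (freshItem {n} {Γ} {Δ} fr))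

renS-≔ : ∀ {f n l} Γ {Δ} → Fresh n Γ Δ → renS (f [ n ≔ l ]) Δ ≡ renS f Δ
renS-≔ {f} {n} {l} Γ {Δ} fr = map-cong-local (All.map (renameLF-≔ f _) (freshLF {n} Γ {Δ} fr))

ra≡ : ∀ {x x' y y' z z'} → x ≡ x' → y ≡ y' → z ≡ z' → ra ⟨ x , y ▷ z ⟩ ≡ ra ⟨ x' , y' ▷ z' ⟩
ra≡ refl refl refl = refl

LS≡ : ∀ {Γ Γ' Δ Δ'} → Γ ≡ Γ' → Δ ≡ Δ' → Γ ⊢LS Δ → Γ' ⊢LS Δ'
LS≡ refl refl d = d

-- With a premise for every label, as in `⊢_`, a rule can be reapplied after a renaming without
-- asking whether its old eigenvariable is still fresh.
∀-A : ∀ {x x' y z u v Γ Δ} → x ≡ x' →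
  (∀ l → (ra ⟨ u , l ▷ z ⟩ ∷ ra ⟨ y , v ▷ l ⟩ ∷ ra ⟨ x , y ▷ z ⟩ ∷ ra ⟨ u , v ▷ x' ⟩ ∷ Γ) ⊢LS Δ) →
  (ra ⟨ x , y ▷ z ⟩ ∷ ra ⟨ u , v ▷ x' ⟩ ∷ Γ) ⊢LS Δ
∀-A {x} {x'} {y} {z} {u} {v} {Γ} {Δ} refl k
  with fresh (labels (ra ⟨ x , y ▷ z ⟩ ∷ ra ⟨ u , v ▷ x ⟩ ∷ Γ) Δ)
... | w , fr = A w fr (k (var w))

∀-AC : ∀ {x x' y Γ Δ} → x ≡ x' →
  (∀ l → (ra ⟨ x , l ▷ x' ⟩ ∷ ra ⟨ y , y ▷ l ⟩ ∷ ra ⟨ x , y ▷ x' ⟩ ∷ Γ) ⊢LS Δ) →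
  (ra ⟨ x , y ▷ x' ⟩ ∷ Γ) ⊢LS Δ
∀-AC {x} {x'} {y} {Γ} {Δ} refl k with fresh (labels (ra ⟨ x , y ▷ x ⟩ ∷ Γ) Δ)
... | w , fr = AC w fr (k (var w))

∀-✱L : ∀ {z F H Γ Δ} →
  (∀ k l → (ra ⟨ k , l ▷ z ⟩ ∷ fm (k ∶ F) ∷ fm (l ∶ H) ∷ Γ) ⊢LS Δ) → (fm (z ∶ F ✱ H) ∷ Γ) ⊢LS Δ
∀-✱L {z} {F} {H} {Γ} {Δ} k with fresh₂ (labels (fm (z ∶ F ✱ H) ∷ Γ) Δ)
... | x , y , x≢y , frx , fry = ✱L x y x≢y frx fry (k (var x) (var y))

∀-−✱R : ∀ {y F H Γ Δ} →
  (∀ k l → (ra ⟨ k , y ▷ l ⟩ ∷ fm (k ∶ F) ∷ Γ) ⊢LS (l ∶ H ∷ Δ)) → Γ ⊢LS (y ∶ F −✱ H ∷ Δ)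
∀-−✱R {y} {F} {H} {Γ} {Δ} k with fresh₂ (labels Γ (y ∶ F −✱ H ∷ Δ))
... | x , z , x≢z , frx , frz = −✱R x z x≢z frx frz (k (var x) (var z))

≡-✱R : ∀ {x y z z' F H Γ Δ} → z ≡ z' →
  (ra ⟨ x , y ▷ z' ⟩ ∷ Γ) ⊢LS (x ∶ F ∷ z ∶ F ✱ H ∷ Δ) →
  (ra ⟨ x , y ▷ z' ⟩ ∷ Γ) ⊢LS (y ∶ H ∷ z ∶ F ✱ H ∷ Δ) →
  (ra ⟨ x , y ▷ z' ⟩ ∷ Γ) ⊢LS (z ∶ F ✱ H ∷ Δ)
≡-✱R refl = ✱R

≡-−✱L : ∀ {x y y' z F H Γ Δ} → y ≡ y' →
  (ra ⟨ x , y' ▷ z ⟩ ∷ fm (y ∶ F −✱ H) ∷ Γ) ⊢LS (x ∶ F ∷ Δ) →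
  (ra ⟨ x , y' ▷ z ⟩ ∷ fm (y ∶ F −✱ H) ∷ fm (z ∶ H) ∷ Γ) ⊢LS Δ →
  (ra ⟨ x , y' ▷ z ⟩ ∷ fm (y ∶ F −✱ H) ∷ Γ) ⊢LS Δ
≡-−✱L refl = −✱L

-- The atom added by the rule is the image of the principal one, so the premise is simply the whole
-- sequent renamed.
LS-Eq₁ : ∀ {w w' Γ Δ} → w ≢ ε → ra ⟨ ε , w ▷ w' ⟩ ∈ Γ →
  renA (subL w' w) Γ ⊢LS renS (subL w' w) Δ → Γ ⊢LS Δ
LS-Eq₁ {w} {w'} {Γ} {Δ} w≢ε m d with front m
... | Γ₀ , π = exch (Eq₁ w≢ε (exch d
    (↭-trans (↭-map⁺ _ (↭-sym π)) (↭-reflexive (cong₂ _∷_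
      (ra≡ (subL-ε w≢ε) (subL-self w' w) (subL-target w' w)) (sym (subA≡renA w' w Γ₀)))))
    (↭-reflexive (sym (subS≡renS w' w Δ))))) π ↭-refl

LS-Eq₂ : ∀ {w w' Γ Δ} → w ≢ ε → ra ⟨ ε , w' ▷ w ⟩ ∈ Γ →
  renA (subL w' w) Γ ⊢LS renS (subL w' w) Δ → Γ ⊢LS Δ
LS-Eq₂ {w} {w'} {Γ} {Δ} w≢ε m d with front m
... | Γ₀ , π = exch (Eq₂ w≢ε (exch d
    (↭-trans (↭-map⁺ _ (↭-sym π)) (↭-reflexive (cong₂ _∷_
      (ra≡ (subL-ε w≢ε) (subL-target w' w) (subL-self w' w)) (sym (subA≡renA w' w Γ₀)))))
    (↭-reflexive (sym (subS≡renS w' w Δ))))) π ↭-refl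

LS-unify : ∀ {a b Γ Δ} → ra ⟨ ε , a ▷ b ⟩ ∈ Γ →
  (∀ g → g ε ≡ ε → g a ≡ g b → renA g Γ ⊢LS renS g Δ) → Γ ⊢LS Δ
LS-unify {a} {b} {Γ} {Δ} m k with a ≟L ε | b ≟L ε
... | no a≢ε | _ = LS-Eq₁ a≢ε m
  (k (subL b a) (subL-ε a≢ε) (trans (subL-self b a) (sym (subL-target b a))))
... | yes refl | no b≢ε = LS-Eq₂ b≢ε m
  (k (subL ε b) (subL-ε b≢ε) (trans (subL-target ε b) (sym (subL-self ε b))))
... | yes refl | yes refl = LS≡ (renA-id Γ) (renS-id Δ) (k id→ refl refl)

subG-ra : ∀ {w w' G Γ} → ra ⟨ ε , w' ▷ w' ⟩ ∈ renA (subL w' w) Γ → (∀ {r} → r ∈ G → ra r ∈ Γ) →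
  ∀ {r} → r ∈ (⟨ ε , w' ▷ w' ⟩ ∷ subG w' w G) → ra r ∈ renA (subL w' w) Γ
subG-ra m s (here refl) = m
subG-ra {w} {w'} m s (there n) with ∈-map⁻ (subRA w' w) n
... | ⟨ _ , _ ▷ _ ⟩ , n' , refl = ∈-map⁺ (renameItem _) (s n')

LS-≐ : ∀ {G u v Γ Δ} → G ⊢E u ≐ v → (∀ {r} → r ∈ G → ra r ∈ Γ) →
  (∀ f → f ε ≡ ε → f u ≡ f v → renA f Γ ⊢LS renS f Δ) → Γ ⊢LS Δ
LS-≐ {Γ = Γ} {Δ} E-done s k = LS≡ (renA-id Γ) (renS-id Δ) (k id→ refl refl)
LS-≐ {Γ = Γ} {Δ} (E-eq₁ {w = w} {w'} m w≢ε d) s k =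
  LS-Eq₁ w≢ε (s m) (LS-≐ d (subG-ra m' s) λ f h e →
    LS≡ (sym (renA-∘ f _ Γ)) (sym (renS-∘ f _ Δ)) (k (f ∘ subL w' w) (trans (cong f (subL-ε w≢ε)) h) e))
  where
  m' = subst (_∈ renA (subL w' w) Γ)
    (ra≡ (subL-ε w≢ε) (subL-self w' w) (subL-target w' w)) (∈-map⁺ (renameItem _) (s m))
LS-≐ {Γ = Γ} {Δ} (E-eq₂ {w = w} {w'} m w≢ε d) s k =
  LS-Eq₂ w≢ε (s m) (LS-≐ d (subG-ra m' s) λ f h e →
    LS≡ (sym (renA-∘ f _ Γ)) (sym (renS-∘ f _ Δ)) (k (f ∘ subL w' w) (trans (cong f (subL-ε w≢ε)) h) e))
  where
  m' = subst (_∈ renA (subL w' w) Γ)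
    (ra≡ (subL-ε w≢ε) (subL-target w' w) (subL-self w' w)) (∈-map⁺ (renameItem _) (s m))

-- The labels x and x' are distinct parameters so that this serves both LS, where they coincide, and
-- ILS, where only f identifies them.
instantiate-A : ∀ {x x' y z u v w Δ f l} Γ W →
  Fresh w (ra ⟨ x , y ▷ z ⟩ ∷ ra ⟨ u , v ▷ x' ⟩ ∷ Γ) Δ →
  (renA (f [ w ≔ l ]) (ra ⟨ u , var w ▷ z ⟩ ∷ ra ⟨ y , v ▷ var w ⟩ ∷
    ra ⟨ x , y ▷ z ⟩ ∷ ra ⟨ u , v ▷ x' ⟩ ∷ Γ) ++ W) ⊢LS renS (f [ w ≔ l ]) Δ →
  (ra ⟨ f u , l ▷ f z ⟩ ∷ ra ⟨ f y , f v ▷ l ⟩ ∷ renA f (ra ⟨ x , y ▷ z ⟩ ∷ ra ⟨ u , v ▷ x' ⟩ ∷ Γ) ++ W)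
    ⊢LS renS f Δ
instantiate-A {x} {x'} {y} {z} {u} {v} {w} {Δ} {f} {l} Γ W fr = LS≡
  (cong₂ _∷_ (ra≡ (old u (there (there (there (here refl))))) new (old z (there (there (here refl)))))
    (cong₂ _∷_ (ra≡ (old y (there (here refl))) (old v (there (there (there (there (here refl)))))) new)
      (cong (_++ W) (renA-≔ Δ fr))))
  (renS-≔ (ra ⟨ x , y ▷ z ⟩ ∷ ra ⟨ u , v ▷ x' ⟩ ∷ Γ) fr)
  where
  old : ∀ k → k ∈ labels (ra ⟨ x , y ▷ z ⟩ ∷ ra ⟨ u , v ▷ x' ⟩ ∷ Γ) Δ → (f [ w ≔ l ]) k ≡ f k
  old k m = ≔-other f k λ { refl → fr m }
  new = ≔-same f w l

instantiate-AC : ∀ {x x' y w Δ f l} Γ W → Fresh w (ra ⟨ x , y ▷ x' ⟩ ∷ Γ) Δ →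
  (renA (f [ w ≔ l ]) (ra ⟨ x , var w ▷ x' ⟩ ∷ ra ⟨ y , y ▷ var w ⟩ ∷ ra ⟨ x , y ▷ x' ⟩ ∷ Γ) ++ W)
    ⊢LS renS (f [ w ≔ l ]) Δ →
  (ra ⟨ f x , l ▷ f x' ⟩ ∷ ra ⟨ f y , f y ▷ l ⟩ ∷ renA f (ra ⟨ x , y ▷ x' ⟩ ∷ Γ) ++ W) ⊢LS renS f Δ
instantiate-AC {x} {x'} {y} {w} {Δ} {f} {l} Γ W fr = LS≡
  (cong₂ _∷_ (ra≡ (old x (here refl)) new (old x' (there (there (here refl)))))
    (cong₂ _∷_ (ra≡ (old y (there (here refl))) (old y (there (here refl))) new)
      (cong (_++ W) (renA-≔ Δ fr))))
  (renS-≔ (ra ⟨ x , y ▷ x' ⟩ ∷ Γ) fr)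
  where
  old : ∀ k → k ∈ labels (ra ⟨ x , y ▷ x' ⟩ ∷ Γ) Δ → (f [ w ≔ l ]) k ≡ f k
  old k m = ≔-other f k λ { refl → fr m }
  new = ≔-same f w l

-- The extra context W absorbs ε ∶ ⊤*, which appears when w is renamed to ε in ⊤*L and which LS cannot decompose.
LS-rename-weaken : ∀ {Γ Δ} → Γ ⊢LS Δ → ∀ f → f ε ≡ ε → ∀ W → (renA f Γ ++ W) ⊢LS renS f Δ
LS-rename-weaken (exch d π ρ) f h W =
  exch (LS-rename-weaken d f h W) (++⁺ʳ W (↭-map⁺ _ π)) (↭-map⁺ _ ρ)
LS-rename-weaken id f h W = id
LS-rename-weaken ⊥L f h W = ⊥L
LS-rename-weaken ⊤R f h W = ⊤R
LS-rename-weaken {Γ} (⊤*R {Δ = Δ}) f h W =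
  subst (λ l → (renA f Γ ++ W) ⊢LS (l ∶ ⊤* ∷ renS f Δ)) (sym h) ⊤*R
LS-rename-weaken (cut {Γ} {Γ'} {Δ} {Δ'} d d') f h W = LS≡
  (trans (cong (_++ (renA f Γ' ++ W)) (++-identityʳ (renA f Γ)))
    (trans (sym (++-assoc (renA f Γ) (renA f Γ') W)) (cong (_++ W) (sym (map-++ _ Γ Γ')))))
  (sym (map-++ _ Δ Δ'))
  -- The contexts of `cut` are added, so W goes into one premise only.
  (cut (LS-rename-weaken d f h []) (LS-rename-weaken d' f h W))
LS-rename-weaken (⊤*L {Γ} {Δ} {w} w≢ε d) f h W with f w ≟L ε
... | yes fw≡ε = exch
  (LS≡ (cong (_++ (fm (f w ∶ ⊤*) ∷ W)) (renA-subA f (trans fw≡ε (sym h)) Γ))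
       (renS-subS f (trans fw≡ε (sym h)) Δ)
       (LS-rename-weaken d f h (fm (f w ∶ ⊤*) ∷ W)))
  (shift _ (renA f Γ) W) ↭-refl
... | no fw≢ε = ⊤*L fw≢ε (LS≡
    (trans (cong₂ _++_ (trans (renA-subA g e Γ) (sym (renA-∘ σ f Γ))) refl)
      (trans (sym (map-++ _ (renA f Γ) W)) (sym (subA≡renA _ _ (renA f Γ ++ W)))))
    (trans (renS-subS g e Δ) (trans (sym (renS-∘ σ f Δ)) (sym (subS≡renS _ _ (renS f Δ)))))
    (LS-rename-weaken d g h' (renA σ W)))
  where
  σ g : Renaming
  σ = subL ε (f w)
  g = σ ∘ f
  h' = trans (cong σ h) (subL-εε (f w))
  e = trans (subL-self ε (f w)) (sym h')
LS-rename-weaken (∧L d) f h W = ∧L (LS-rename-weaken d f h W)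
LS-rename-weaken (∧R d d') f h W = ∧R (LS-rename-weaken d f h W) (LS-rename-weaken d' f h W)
LS-rename-weaken (⇒L d d') f h W = ⇒L (LS-rename-weaken d f h W) (LS-rename-weaken d' f h W)
LS-rename-weaken (⇒R d) f h W = ⇒R (LS-rename-weaken d f h W)
LS-rename-weaken (✱L {Γ} {Δ} {z} {F} {H} x y x≢y frx fry d) f h W = ∀-✱L λ k l →
  let f' = f [ x ≔ k ]
      gx = trans (≔-other f' {y} {l} (var x) (λ { refl → x≢y refl })) (≔-same f x k)
      gy = ≔-same f' y l
      gz = trans (≔-other f' {y} {l} z (λ { refl → fry (here refl) }))
                 (≔-other f {x} {k} z (λ { refl → frx (here refl) }))
  in LS≡
    (cong₂ _∷_ (ra≡ gx gy gz) (cong₂ _∷_ (cong (λ l → fm (l ∶ F)) gx) (cong₂ _∷_ (cong (λ l → fm (l ∶ H)) gy)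
      (cong (_++ W) (trans (renA-≔ Δ (fry ∘ there)) (renA-≔ Δ (frx ∘ there)))))))
    (trans (renS-≔ (fm (z ∶ F ✱ H) ∷ Γ) fry) (renS-≔ (fm (z ∶ F ✱ H) ∷ Γ) frx))
    (LS-rename-weaken d (f' [ y ≔ l ]) h W)
LS-rename-weaken (−✱R {Γ} {Δ} {y} {F} {H} x z x≢z frx frz d) f h W = ∀-−✱R λ k l →
  let f' = f [ x ≔ k ]
      gx = trans (≔-other f' {z} {l} (var x) (λ { refl → x≢z refl })) (≔-same f x k)
      gz = ≔-same f' z l
      gy = trans (≔-other f' {z} {l} y (λ { refl → frz (∈-++⁺ʳ (concatMap labsItem Γ) (here refl)) }))
                 (≔-other f {x} {k} y (λ { refl → frx (∈-++⁺ʳ (concatMap labsItem Γ) (here refl)) }))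
      Δ' = y ∶ F −✱ H ∷ Δ
  in LS≡
    (cong₂ _∷_ (ra≡ gx gy gz) (cong₂ _∷_ (cong (λ l → fm (l ∶ F)) gx)
      (cong (_++ W) (trans (renA-≔ Δ' frz) (renA-≔ Δ' frx)))))
    (cong₂ _∷_ (cong (_∶ H) gz) (∷-injectiveʳ (trans (renS-≔ Γ {Δ'} frz) (renS-≔ Γ {Δ'} frx))))
    (LS-rename-weaken d (f' [ z ≔ l ]) h W)
LS-rename-weaken (✱R d d') f h W = ✱R (LS-rename-weaken d f h W) (LS-rename-weaken d' f h W)
LS-rename-weaken (−✱L d d') f h W = −✱L (LS-rename-weaken d f h W) (LS-rename-weaken d' f h W)
LS-rename-weaken (E d) f h W = E (LS-rename-weaken d f h W)
LS-rename-weaken {Γ} {Δ} (U {x = x} d) f h W = U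
  (subst (λ l → (ra ⟨ f x , l ▷ f x ⟩ ∷ renA f Γ ++ W) ⊢LS renS f Δ) h (LS-rename-weaken d f h W))
LS-rename-weaken (A {Γ} w fr d) f h W = ∀-A refl λ l →
  instantiate-A Γ W fr (LS-rename-weaken d (f [ w ≔ l ]) h W)
LS-rename-weaken (AC {Γ} w fr d) f h W = ∀-AC refl λ l →
  instantiate-AC Γ W fr (LS-rename-weaken d (f [ w ≔ l ]) h W)
LS-rename-weaken (Eq₁ {Γ} {Δ} {w} {w'} w≢ε d) f h W = LS-unify (here (ra≡ (sym h) refl refl)) λ g gε e →
  LS≡ (cong₂ _∷_ (ra≡ refl (sym e) refl) (trans
        (cong (_++ renA g W) (trans (renA-subA (g ∘ f) e Γ) (sym (renA-∘ g f Γ))))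
        (sym (map-++ _ (renA f Γ) W))))
      (trans (renS-subS (g ∘ f) e Δ) (sym (renS-∘ g f Δ)))
      (LS-rename-weaken d (g ∘ f) (trans (cong g h) gε) (renA g W))
LS-rename-weaken (Eq₂ {Γ} {Δ} {w} {w'} w≢ε d) f h W = LS-unify (here (ra≡ (sym h) refl refl)) λ g gε e →
  LS≡ (cong₂ _∷_ (ra≡ refl refl e) (trans
        (cong (_++ renA g W) (trans (renA-subA (g ∘ f) (sym e) Γ) (sym (renA-∘ g f Γ))))
        (sym (map-++ _ (renA f Γ) W))))
      (trans (renS-subS (g ∘ f) (sym e) Δ) (sym (renS-∘ g f Δ)))
      (LS-rename-weaken d (g ∘ f) (trans (cong g h) gε) (renA g W))

LS-rename : ∀ {Γ Δ} → Γ ⊢LS Δ → ∀ f → f ε ≡ ε → renA f Γ ⊢LS renS f Δ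
LS-rename {Γ} d f h = LS≡ (++-identityʳ (renA f Γ)) refl (LS-rename-weaken d f h [])

LS-weaken : ∀ {Γ Δ} → Γ ⊢LS Δ → ∀ i → (i ∷ Γ) ⊢LS Δ
LS-weaken {Γ} {Δ} d i = exch (LS≡ (cong (_++ (i ∷ [])) (renA-id Γ)) (renS-id Δ)
  (LS-rename-weaken d id→ refl (i ∷ [])))
  (↭-trans (shift i Γ []) (↭-reflexive (cong (i ∷_) (++-identityʳ Γ)))) ↭-refl

-- From ILS to LS, and the equivalence

ILS⇒LS : ∀ {Γ Δ} → Γ ⊢ILS Δ → Γ ⊢LS Δ
ILS⇒LS (exch d π ρ) = exch (ILS⇒LS d) π ρ
ILS⇒LS (id {Γ} {Δ} {w₁} {w₂} {p} e) = LS-≐ e rels-∈-ra λ f h eq →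
  subst (λ l → renA f (fm (w₁ ∶ atom p) ∷ Γ) ⊢LS (l ∶ atom p ∷ renS f Δ)) eq id
ILS⇒LS ⊥L = ⊥L
ILS⇒LS ⊤R = ⊤R
ILS⇒LS (⊤*R {Γ} {Δ} e) = LS-≐ e rels-∈-ra λ f h eq →
  subst (λ l → renA f Γ ⊢LS (l ∶ ⊤* ∷ renS f Δ)) (sym (trans eq h)) ⊤*R
ILS⇒LS (⊤*L {Γ} {Δ} {w} d) with w ≟L ε
-- If w is `ε`, the added atom is (ε,ε ▷ ε), which `U` discharges, and the formula is weakened in.
-- Otherwise renaming w to `ε` produces the same atom.
... | yes refl = LS-weaken (U (ILS⇒LS d)) _
... | no w≢ε = ⊤*L w≢ε (U (LS≡
  (cong₂ _∷_ (ra≡ (subL-ε w≢ε) (subL-self ε w) (subL-ε w≢ε)) (sym (subA≡renA ε w Γ)))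
  (sym (subS≡renS ε w Δ))
  (LS-rename (ILS⇒LS d) (subL ε w) (subL-ε w≢ε))))
ILS⇒LS (∧L d) = ∧L (ILS⇒LS d)
ILS⇒LS (∧R d d') = ∧R (ILS⇒LS d) (ILS⇒LS d')
ILS⇒LS (⇒L d d') = ⇒L (ILS⇒LS d) (ILS⇒LS d')
ILS⇒LS (⇒R d) = ⇒R (ILS⇒LS d)
ILS⇒LS (✱L x y x≢y frx fry d) = ✱L x y x≢y frx fry (ILS⇒LS d)
ILS⇒LS (−✱R x z x≢z frx frz d) = −✱R x z x≢z frx frz (ILS⇒LS d)
ILS⇒LS (✱R e d d') = LS-≐ e rels-∈-ra λ f h eq →
  ≡-✱R eq (LS-rename (ILS⇒LS d) f h) (LS-rename (ILS⇒LS d') f h)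
ILS⇒LS (−✱L e d d') = LS-≐ e rels-∈-ra λ f h eq →
  ≡-−✱L eq (LS-rename (ILS⇒LS d) f h) (LS-rename (ILS⇒LS d') f h)
ILS⇒LS (E d) = E (ILS⇒LS d)
ILS⇒LS (U d) = U (ILS⇒LS d)
ILS⇒LS (A {Γ} w e fr d) = LS-≐ e rels-∈-ra λ f h eq → ∀-A eq λ l →
  LS≡ (++-identityʳ _) refl (instantiate-A Γ [] fr (LS-rename-weaken (ILS⇒LS d) (f [ w ≔ l ]) h []))
ILS⇒LS (AC {Γ} w e fr d) = LS-≐ e rels-∈-ra λ f h eq → ∀-AC eq λ l →
  LS≡ (++-identityʳ _) refl (instantiate-AC Γ [] fr (LS-rename-weaken (ILS⇒LS d) (f [ w ≔ l ]) h []))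

theorem4 : ∀ (Γ : Ante) (Δ : Succ) → (Γ ⊢LS Δ → Γ ⊢ILS Δ) × (Γ ⊢ILS Δ → Γ ⊢LS Δ)
theorem4 Γ Δ = (λ d → ⊢⇒ILS (LS⇒⊢ d id→ refl present-all) Γ Δ (present ∘ ∈⇒⊩)) , ILS⇒LS
  where
  present-all : seq Γ Δ ⊩[ id→ ] Γ ⇒ Δ
  present-all =
    All.tabulate (λ {i} m → subst (λ i → seq Γ Δ ⊩ left i) (sym (renameItem-id i)) (∈⇒⊩ (left-∈ m))) &
    All.tabulate (λ {j} m → subst (λ j → seq Γ Δ ⊩ right j) (sym (renameLF-id j)) (∈⇒⊩ (right-∈ Γ m)))
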